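{- Let $G$ be a connected $k$-regular graph on $n\ge 2$ vertices. Then $h_G<\sqrt{n-1}\,\gamma(G)$, where $h_G$ is the Cheeger constant of $G$.
   Context: For a finite simple undirected graph $G$ with $n$ vertices, let $\mathcal{F}=\{x\in\mathbb{R}^{V(G)} : \sum_{v} x_v = 0,\ \|x\|_\infty = 1\}$, for $x\in\mathcal{F}$ let $\gamma_x(G)=\max_{uv\in E(G)}|x_u-x_v|$, and $\gamma(G)=\min_{x\in\mathcal{F}}\gamma_x(G)$. For $S\subseteq V(G)$, $\operatorname{vol}(S)=\sum_{u\in S}\deg(u)$; for nonempty proper $S\subsetneq V(G)$, $\partial S$ is the set of edges with exactly one endpoint in $S$, $h_G(S)=|\partial S|/\min(\operatorname{vol}(S),\operatorname{vol}(V(G)\setminus S))$, and $h_G=\min_S h_G(S)$ over nonempty proper subsets $S$. -}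

module Defs where

open import Data.Fin using (Fin)
import Data.Fin as Fin
import Data.Fin.Properties as Fin
open import Data.Fin.Subset using (Subset; _∈_; _∉_; _⊂_; Nonempty; ⊤; ∁)
open import Data.Fin.Subset.Properties using (_∈?_)
open import Data.Integer using (+_; -[1+_]; +≤+; +<+)
import Data.Integer as ℤ
import Data.Integer.Properties as ℤ
import Data.Integer.Solver as ℤSolver
open import Data.List using (List; foldr; map; filter; length; allFin; cartesianProduct)
open import Data.Nat.ListAction using (sum)
open import Data.Nat using (ℕ; zero; suc)
import Data.Nat as ℕ
import Data.Nat.Properties as ℕ
open import Data.Nat.Solver using (module +-*-Solver)
open import Data.Product using (_×_; _,_; ∃-syntax)
open import Data.Rational using (ℚ; mkℚ; 0ℚ; 1ℚ; _/_; ∣_∣; *<*; positive)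
import Data.Rational as ℚ
import Data.Rational.Properties as ℚ
import Data.Rational.Solver as ℚSolver
import Data.Rational.Unnormalised as ℚᵘ
import Data.Rational.Unnormalised.Properties as ℚᵘ
open import Data.Sum using (_⊎_; inj₁; inj₂)
open import Level using (0ℓ)
open import Relation.Binary using (Rel; Symmetric; Irreflexive; Decidable)
open import Relation.Binary.Construct.Closure.ReflexiveTransitive using (Star)
open import Relation.Binary.PropositionalEquality
open import Relation.Nullary using (yes; no)
open import Relation.Nullary.Decidable using (_×-dec_; _⊎-dec_; ¬?)

Cauchy : (ℕ → ℚ) → Set
Cauchy f = ∀ ε → 0ℚ ℚ.< ε →
           ∃[ N ] (∀ m n → N ℕ.≤ m → N ℕ.≤ n → ∣ f m ℚ.- f n ∣ ℚ.< ε)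

record ℝ : Set where
  constructor mkℝ
  field
    seq    : ℕ → ℚ
    cauchy : Cauchy seq

open ℝ public

infix 4 _≃ℝ_ _≤ℝ_ _<ℝ_

_≃ℝ_ _≤ℝ_ _<ℝ_ : Rel ℝ 0ℓ
x ≃ℝ y = ∀ ε → 0ℚ ℚ.< ε → ∃[ N ] (∀ m → N ℕ.≤ m → ∣ seq x m ℚ.- seq y m ∣ ℚ.< ε)
x ≤ℝ y = ∀ ε → 0ℚ ℚ.< ε → ∃[ N ] (∀ m → N ℕ.≤ m → seq x m ℚ.< seq y m ℚ.+ ε)
x <ℝ y = ∃[ ε ] (0ℚ ℚ.< ε × ∃[ N ] (∀ m → N ℕ.≤ m → seq x m ℚ.+ ε ℚ.< seq y m))

module CauchyLemmas where
  module Identities where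
    open ℚSolver.+-*-Solver

    cancel : ∀ q s → (q ℚ.+ s) ℚ.- q ≡ s
    cancel = solve 2 (λ q s → (q :+ s) :- q := s) refl

    swap : ∀ p q → ℚ.- (p ℚ.- q) ≡ q ℚ.- p
    swap = solve 2 (λ p q → :- (p :- q) := q :- p) refl

    split : ∀ p q → q ℚ.+ (p ℚ.- q) ≡ p
    split = solve 2 (λ p q → q :+ (p :- q) := p) refl

    +-diff : ∀ a b c d → (a ℚ.- c) ℚ.+ (b ℚ.- d) ≡ (a ℚ.+ b) ℚ.- (c ℚ.+ d)
    +-diff = solve 4 (λ a b c d → (a :- c) :+ (b :- d) := (a :+ b) :- (c :+ d)) refl

    -‿diff : ∀ a b c d → (a ℚ.- c) ℚ.- (b ℚ.- d) ≡ (a ℚ.- b) ℚ.- (c ℚ.- d)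
    -‿diff = solve 4 (λ a b c d → (a :- c) :- (b :- d) := (a :- b) :- (c :- d)) refl

    *-diff : ∀ a b c d →
      a ℚ.* b ℚ.- c ℚ.* d ≡ a ℚ.* (b ℚ.- d) ℚ.+ d ℚ.* (a ℚ.- c)
    *-diff = solve 4 (λ a b c d → a :* b :- c :* d := a :* (b :- d) :+ d :* (a :- c)) refl

  open Identities

  0<1 : 0ℚ ℚ.< 1ℚ
  0<1 = ℚ.positive⁻¹ 1ℚ

  ∣p-q∣≤ : ∀ {p q s} → p ℚ.≤ q ℚ.+ s → q ℚ.≤ p ℚ.+ s → ∣ p ℚ.- q ∣ ℚ.≤ s
  ∣p-q∣≤ {p} {q} {s} p≤ q≤ with ℚ.∣p∣≡p∨∣p∣≡-p (p ℚ.- q)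
  ... | inj₁ eq = begin
    ∣ p ℚ.- q ∣         ≡⟨ eq ⟩
    p ℚ.- q             ≤⟨ ℚ.+-monoˡ-≤ (ℚ.- q) p≤ ⟩
    (q ℚ.+ s) ℚ.- q     ≡⟨ cancel q s ⟩
    s                   ∎
    where open ℚ.≤-Reasoning
  ... | inj₂ eq = begin
    ∣ p ℚ.- q ∣         ≡⟨ eq ⟩
    ℚ.- (p ℚ.- q)       ≡⟨ swap p q ⟩
    q ℚ.- p             ≤⟨ ℚ.+-monoˡ-≤ (ℚ.- p) q≤ ⟩
    (p ℚ.+ s) ℚ.- p     ≡⟨ cancel p s ⟩
    s                   ∎
    where open ℚ.≤-Reasoning

  p≤∣p∣ : ∀ p → p ℚ.≤ ∣ p ∣
  p≤∣p∣ p with ℚ.≤-total 0ℚ p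
  ... | inj₁ 0≤p = ℚ.≤-reflexive (sym (ℚ.0≤p⇒∣p∣≡p 0≤p))
  ... | inj₂ p≤0 = ℚ.≤-trans p≤0 (ℚ.0≤∣p∣ p)

  ∣p-q∣-comm : ∀ p q → ∣ p ℚ.- q ∣ ≡ ∣ q ℚ.- p ∣
  ∣p-q∣-comm p q = trans (sym (ℚ.∣-p∣≡∣p∣ (p ℚ.- q))) (cong ∣_∣ (swap p q))

  p≤q+∣p-q∣ : ∀ p q → p ℚ.≤ q ℚ.+ ∣ p ℚ.- q ∣
  p≤q+∣p-q∣ p q = begin
    p                     ≡⟨ split p q ⟨
    q ℚ.+ (p ℚ.- q)       ≤⟨ ℚ.+-monoʳ-≤ q (p≤∣p∣ (p ℚ.- q)) ⟩
    q ℚ.+ ∣ p ℚ.- q ∣     ∎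
    where open ℚ.≤-Reasoning

  ∣p∣≤∣q∣+∣p-q∣ : ∀ p q → ∣ p ∣ ℚ.≤ ∣ q ∣ ℚ.+ ∣ p ℚ.- q ∣
  ∣p∣≤∣q∣+∣p-q∣ p q = begin
    ∣ p ∣                     ≡⟨ cong ∣_∣ (split p q) ⟨
    ∣ q ℚ.+ (p ℚ.- q) ∣       ≤⟨ ℚ.∣p+q∣≤∣p∣+∣q∣ q (p ℚ.- q) ⟩
    ∣ q ∣ ℚ.+ ∣ p ℚ.- q ∣     ∎
    where open ℚ.≤-Reasoning

  halve : ∀ ε → 0ℚ ℚ.< ε → 0ℚ ℚ.< ℚ.½ ℚ.* ε
  halve ε ε>0 = ℚ.positive⁻¹ (ℚ.½ ℚ.* ε) {{ℚ.pos*pos⇒pos ℚ.½ ε {{positive ε>0}}}}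

  halves : ∀ ε → ℚ.½ ℚ.* ε ℚ.+ ℚ.½ ℚ.* ε ≡ ε
  halves ε = trans (sym (ℚ.*-distribʳ-+ ε ℚ.½ ℚ.½)) (ℚ.*-identityˡ ε)

  Lipschitz₁ : (ℚ → ℚ) → Set
  Lipschitz₁ f = ∀ a c → ∣ f a ℚ.- f c ∣ ℚ.≤ ∣ a ℚ.- c ∣

  Lipschitz₂ : (ℚ → ℚ → ℚ) → Set
  Lipschitz₂ _∙_ = ∀ a b c d →
    ∣ (a ∙ b) ℚ.- (c ∙ d) ∣ ℚ.≤ ∣ a ℚ.- c ∣ ℚ.+ ∣ b ℚ.- d ∣

  lift₁-cauchy : ∀ f → Lipschitz₁ f → (x : ℝ) → Cauchy (λ m → f (seq x m))
  lift₁-cauchy f lip x ε ε>0 with cauchy x ε ε>0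
  ... | N , close = N , λ m n N≤m N≤n →
    ℚ.≤-<-trans (lip (seq x m) (seq x n)) (close m n N≤m N≤n)

  lift₂-cauchy : ∀ _∙_ → Lipschitz₂ _∙_ → (x y : ℝ) → Cauchy (λ m → seq x m ∙ seq y m)
  lift₂-cauchy _∙_ lip x y ε ε>0
    with cauchy x (ℚ.½ ℚ.* ε) (halve ε ε>0) | cauchy y (ℚ.½ ℚ.* ε) (halve ε ε>0)
  ... | M , closeˣ | N , closeʸ = M ℕ.+ N , λ m n p q → begin-strict
    ∣ (seq x m ∙ seq y m) ℚ.- (seq x n ∙ seq y n) ∣
      ≤⟨ lip (seq x m) (seq y m) (seq x n) (seq y n) ⟩
    ∣ seq x m ℚ.- seq x n ∣ ℚ.+ ∣ seq y m ℚ.- seq y n ∣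
      <⟨ ℚ.+-mono-<
           (closeˣ m n (ℕ.m+n≤o⇒m≤o M p) (ℕ.m+n≤o⇒m≤o M q))
           (closeʸ m n (ℕ.m+n≤o⇒n≤o M p) (ℕ.m+n≤o⇒n≤o M q)) ⟩
    ℚ.½ ℚ.* ε ℚ.+ ℚ.½ ℚ.* ε
      ≡⟨ halves ε ⟩
    ε ∎
    where open ℚ.≤-Reasoning

  +-lipschitz : Lipschitz₂ ℚ._+_
  +-lipschitz a b c d = begin
    ∣ (a ℚ.+ b) ℚ.- (c ℚ.+ d) ∣       ≡⟨ cong ∣_∣ (+-diff a b c d) ⟨
    ∣ (a ℚ.- c) ℚ.+ (b ℚ.- d) ∣       ≤⟨ ℚ.∣p+q∣≤∣p∣+∣q∣ (a ℚ.- c) (b ℚ.- d) ⟩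
    ∣ a ℚ.- c ∣ ℚ.+ ∣ b ℚ.- d ∣       ∎
    where open ℚ.≤-Reasoning

  -‿lipschitz : Lipschitz₂ ℚ._-_
  -‿lipschitz a b c d = begin
    ∣ (a ℚ.- b) ℚ.- (c ℚ.- d) ∣       ≡⟨ cong ∣_∣ (-‿diff a b c d) ⟨
    ∣ (a ℚ.- c) ℚ.- (b ℚ.- d) ∣       ≤⟨ ℚ.∣p-q∣≤∣p∣+∣q∣ (a ℚ.- c) (b ℚ.- d) ⟩
    ∣ a ℚ.- c ∣ ℚ.+ ∣ b ℚ.- d ∣       ∎
    where open ℚ.≤-Reasoning

  ⊔-lipschitz : Lipschitz₂ ℚ._⊔_
  ⊔-lipschitz a b c d = ∣p-q∣≤ (half a b c d)
    (subst₂ (λ s t → c ℚ.⊔ d ℚ.≤ a ℚ.⊔ b ℚ.+ (s ℚ.+ t)) (∣p-q∣-comm c a) (∣p-q∣-comm d b)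
      (half c d a b))
    where
    open ℚ.≤-Reasoning
    half : ∀ a b c d → a ℚ.⊔ b ℚ.≤ c ℚ.⊔ d ℚ.+ (∣ a ℚ.- c ∣ ℚ.+ ∣ b ℚ.- d ∣)
    half a b c d = ℚ.⊔-lub
      (begin
        a                                                ≤⟨ p≤q+∣p-q∣ a c ⟩
        c ℚ.+ ∣ a ℚ.- c ∣                                ≡⟨ cong (c ℚ.+_) (ℚ.+-identityʳ ∣ a ℚ.- c ∣) ⟨
        c ℚ.+ (∣ a ℚ.- c ∣ ℚ.+ 0ℚ)                       ≤⟨ ℚ.+-mono-≤ (ℚ.p≤p⊔q c d)
          (ℚ.+-monoʳ-≤ ∣ a ℚ.- c ∣ (ℚ.0≤∣p∣ (b ℚ.- d))) ⟩
        c ℚ.⊔ d ℚ.+ (∣ a ℚ.- c ∣ ℚ.+ ∣ b ℚ.- d ∣)        ∎)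
      (begin
        b                                                ≤⟨ p≤q+∣p-q∣ b d ⟩
        d ℚ.+ ∣ b ℚ.- d ∣                                ≡⟨ cong (d ℚ.+_) (ℚ.+-identityˡ ∣ b ℚ.- d ∣) ⟨
        d ℚ.+ (0ℚ ℚ.+ ∣ b ℚ.- d ∣)                       ≤⟨ ℚ.+-mono-≤ (ℚ.p≤q⊔p c d)
          (ℚ.+-monoˡ-≤ ∣ b ℚ.- d ∣ (ℚ.0≤∣p∣ (a ℚ.- c))) ⟩
        c ℚ.⊔ d ℚ.+ (∣ a ℚ.- c ∣ ℚ.+ ∣ b ℚ.- d ∣)        ∎)

  ∣∣-lipschitz : Lipschitz₁ ∣_∣
  ∣∣-lipschitz a c = ∣p-q∣≤ (∣p∣≤∣q∣+∣p-q∣ a c)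
    (subst (λ s → ∣ c ∣ ℚ.≤ ∣ a ∣ ℚ.+ s) (∣p-q∣-comm c a) (∣p∣≤∣q∣+∣p-q∣ c a))

  eventuallyBounded : (x : ℝ) →
    ∃[ K ] (0ℚ ℚ.< K × ∃[ N ] (∀ m → N ℕ.≤ m → ∣ seq x m ∣ ℚ.≤ K))
  eventuallyBounded x with cauchy x 1ℚ 0<1
  ... | N , close = ∣ seq x N ∣ ℚ.+ 1ℚ , positivity , N , λ m N≤m → begin
      ∣ seq x m ∣                                     ≤⟨ ∣p∣≤∣q∣+∣p-q∣ (seq x m) (seq x N) ⟩
      ∣ seq x N ∣ ℚ.+ ∣ seq x m ℚ.- seq x N ∣
        ≤⟨ ℚ.+-monoʳ-≤ ∣ seq x N ∣ (ℚ.<⇒≤ (close m N N≤m ℕ.≤-refl)) ⟩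
      ∣ seq x N ∣ ℚ.+ 1ℚ                              ∎
    where
    open ℚ.≤-Reasoning
    positivity : 0ℚ ℚ.< ∣ seq x N ∣ ℚ.+ 1ℚ
    positivity = ℚ.positive⁻¹ (∣ seq x N ∣ ℚ.+ 1ℚ)
      {{ℚ.nonNeg+pos⇒pos ∣ seq x N ∣ {{ℚ.∣-∣-nonNeg (seq x N)}} 1ℚ}}

  *-bound : ∀ {P δ} u v → 0ℚ ℚ.< P → ∣ u ∣ ℚ.≤ P → ∣ v ∣ ℚ.< δ → ∣ u ℚ.* v ∣ ℚ.< P ℚ.* δ
  *-bound {P} {δ} u v P>0 u≤ v< = begin-strict
    ∣ u ℚ.* v ∣           ≡⟨ ℚ.∣p*q∣≡∣p∣*∣q∣ u v ⟩
    ∣ u ∣ ℚ.* ∣ v ∣       ≤⟨ ℚ.*-monoʳ-≤-nonNeg ∣ v ∣ {{ℚ.∣-∣-nonNeg v}} u≤ ⟩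
    P ℚ.* ∣ v ∣           <⟨ ℚ.*-monoʳ-<-pos P {{positive P>0}} v< ⟩
    P ℚ.* δ               ∎
    where open ℚ.≤-Reasoning

  divide : ∀ K L ε → 0ℚ ℚ.< K → 0ℚ ℚ.< L → 0ℚ ℚ.< ε →
           ∃[ δ ] (0ℚ ℚ.< δ × K ℚ.* δ ℚ.+ L ℚ.* δ ≡ ε)
  divide K L ε K>0 L>0 ε>0 =
    1/S ℚ.* ε ,
    ℚ.positive⁻¹ (1/S ℚ.* ε) {{ℚ.pos*pos⇒pos 1/S {{ℚ.1/pos⇒pos S}} ε {{positive ε>0}}}} ,
    (begin
      K ℚ.* (1/S ℚ.* ε) ℚ.+ L ℚ.* (1/S ℚ.* ε)   ≡⟨ ℚ.*-distribʳ-+ (1/S ℚ.* ε) K L ⟨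
      S ℚ.* (1/S ℚ.* ε)                         ≡⟨ ℚ.*-assoc S 1/S ε ⟨
      S ℚ.* 1/S ℚ.* ε                           ≡⟨ cong (ℚ._* ε) (ℚ.*-inverseʳ S) ⟩
      1ℚ ℚ.* ε                                  ≡⟨ ℚ.*-identityˡ ε ⟩
      ε                                         ∎)
    where
    open ≡-Reasoning
    S = K ℚ.+ L
    instance
      S-pos : ℚ.Positive S
      S-pos = ℚ.pos+pos⇒pos K {{positive K>0}} L {{positive L>0}}
      S-nonZero : ℚ.NonZero S
      S-nonZero = ℚ.pos⇒nonZero S
    1/S = ℚ.1/ S

  *-cauchy : (x y : ℝ) → Cauchy (λ m → seq x m ℚ.* seq y m)
  *-cauchy x y ε ε>0 =
    let K , K>0 , A , boundˣ = eventuallyBounded x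
        L , L>0 , B , boundʸ = eventuallyBounded y
        δ , δ>0 , Kδ+Lδ≡ε    = divide K L ε K>0 L>0 ε>0
        C , closeˣ           = cauchy x δ δ>0
        D , closeʸ           = cauchy y δ δ>0
        A≤ : ∀ {k} → A ℕ.+ B ℕ.+ (C ℕ.+ D) ℕ.≤ k → A ℕ.≤ k
        A≤ p = ℕ.m+n≤o⇒m≤o A (ℕ.m+n≤o⇒m≤o (A ℕ.+ B) p)
        B≤ : ∀ {k} → A ℕ.+ B ℕ.+ (C ℕ.+ D) ℕ.≤ k → B ℕ.≤ k
        B≤ p = ℕ.m+n≤o⇒n≤o A (ℕ.m+n≤o⇒m≤o (A ℕ.+ B) p)
        C≤ : ∀ {k} → A ℕ.+ B ℕ.+ (C ℕ.+ D) ℕ.≤ k → C ℕ.≤ k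
        C≤ p = ℕ.m+n≤o⇒m≤o C (ℕ.m+n≤o⇒n≤o (A ℕ.+ B) p)
        D≤ : ∀ {k} → A ℕ.+ B ℕ.+ (C ℕ.+ D) ℕ.≤ k → D ℕ.≤ k
        D≤ p = ℕ.m+n≤o⇒n≤o C (ℕ.m+n≤o⇒n≤o (A ℕ.+ B) p)
    in A ℕ.+ B ℕ.+ (C ℕ.+ D) , λ m n p q → begin-strict
      ∣ seq x m ℚ.* seq y m ℚ.- seq x n ℚ.* seq y n ∣
        ≡⟨ cong ∣_∣ (*-diff (seq x m) (seq y m) (seq x n) (seq y n)) ⟩
      ∣ seq x m ℚ.* (seq y m ℚ.- seq y n) ℚ.+ seq y n ℚ.* (seq x m ℚ.- seq x n) ∣
        ≤⟨ ℚ.∣p+q∣≤∣p∣+∣q∣ (seq x m ℚ.* (seq y m ℚ.- seq y n)) (seq y n ℚ.* (seq x m ℚ.- seq x n)) ⟩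
      ∣ seq x m ℚ.* (seq y m ℚ.- seq y n) ∣ ℚ.+ ∣ seq y n ℚ.* (seq x m ℚ.- seq x n) ∣
        <⟨ ℚ.+-mono-<
             (*-bound (seq x m) (seq y m ℚ.- seq y n) K>0 (boundˣ m (A≤ p)) (closeʸ m n (D≤ p) (D≤ q)))
             (*-bound (seq y n) (seq x m ℚ.- seq x n) L>0 (boundʸ n (B≤ q)) (closeˣ m n (C≤ p) (C≤ q))) ⟩
      K ℚ.* δ ℚ.+ L ℚ.* δ
        ≡⟨ Kδ+Lδ≡ε ⟩
      ε ∎
    where open ℚ.≤-Reasoning

open CauchyLemmas

fromℚ : ℚ → ℝ
fromℚ p = mkℝ (λ _ → p) λ ε ε>0 → 0 , λ _ _ _ _ →
  subst (λ t → ∣ t ∣ ℚ.< ε) (sym (ℚ.+-inverseʳ p)) ε>0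

0ℝ 1ℝ : ℝ
0ℝ = fromℚ 0ℚ
1ℝ = fromℚ 1ℚ

infixl 6 _+ℝ_ _-ℝ_ _⊔ℝ_
infixl 7 _*ℝ_

_+ℝ_ _-ℝ_ _*ℝ_ _⊔ℝ_ : ℝ → ℝ → ℝ
x +ℝ y = mkℝ (λ m → seq x m ℚ.+ seq y m) (lift₂-cauchy ℚ._+_ +-lipschitz x y)
x -ℝ y = mkℝ (λ m → seq x m ℚ.- seq y m) (lift₂-cauchy ℚ._-_ -‿lipschitz x y)
x *ℝ y = mkℝ (λ m → seq x m ℚ.* seq y m) (*-cauchy x y)
x ⊔ℝ y = mkℝ (λ m → seq x m ℚ.⊔ seq y m) (lift₂-cauchy ℚ._⊔_ ⊔-lipschitz x y)

∣_∣ℝ : ℝ → ℝ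
∣ x ∣ℝ = mkℝ (λ m → ∣ seq x m ∣) (lift₁-cauchy ∣_∣ ∣∣-lipschitz x)

⌊√_⌋ : ℕ → ℕ
⌊√ zero ⌋ = 0
⌊√ suc n ⌋ with suc ⌊√ n ⌋ ℕ.* suc ⌊√ n ⌋ ℕ.≤? suc n
... | yes _ = suc ⌊√ n ⌋
... | no  _ = ⌊√ n ⌋

⌊√⌋-lower : ∀ n → ⌊√ n ⌋ ℕ.* ⌊√ n ⌋ ℕ.≤ n
⌊√⌋-lower zero = ℕ.z≤n
⌊√⌋-lower (suc n) with suc ⌊√ n ⌋ ℕ.* suc ⌊√ n ⌋ ℕ.≤? suc n
... | yes p = p
... | no  _ = ℕ.m≤n⇒m≤1+n (⌊√⌋-lower n)

⌊√⌋-upper : ∀ n → n ℕ.< suc ⌊√ n ⌋ ℕ.* suc ⌊√ n ⌋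
⌊√⌋-upper zero = ℕ.s≤s ℕ.z≤n
⌊√⌋-upper (suc n) with suc ⌊√ n ⌋ ℕ.* suc ⌊√ n ⌋ ℕ.≤? suc n
... | yes _ = ℕ.≤-<-trans (⌊√⌋-upper n)
  (ℕ.*-mono-< (ℕ.n<1+n (suc ⌊√ n ⌋)) (ℕ.n<1+n (suc ⌊√ n ⌋)))
... | no ¬p = ℕ.≰⇒> ¬p

-- The largest multiple of 1/(m+1) that does not exceed √n.
√-approx : ℕ → ℕ → ℚ
√-approx n m = + ⌊√ n ℕ.* (suc m ℕ.* suc m) ⌋ / suc m

module √Lemmas where
  square-cancel-< : ∀ {a b} → a ℕ.* a ℕ.< b ℕ.* b → a ℕ.< b
  square-cancel-< a²<b² = ℕ.≰⇒> λ b≤a → ℕ.<⇒≱ a²<b² (ℕ.*-mono-≤ b≤a b≤a)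

  cross : ∀ n m k → let r = λ i → ⌊√ n ℕ.* (suc i ℕ.* suc i) ⌋ in
          r m ℕ.* suc k ℕ.< suc (r k) ℕ.* suc m
  cross n m k = square-cancel-< (begin-strict
    (a ℕ.* k′) ℕ.* (a ℕ.* k′)             ≡⟨ square-* a k′ ⟩
    (a ℕ.* a) ℕ.* (k′ ℕ.* k′)
      ≤⟨ ℕ.*-monoˡ-≤ (k′ ℕ.* k′) (⌊√⌋-lower (n ℕ.* (m′ ℕ.* m′))) ⟩
    (n ℕ.* (m′ ℕ.* m′)) ℕ.* (k′ ℕ.* k′)
      ≡⟨ solve 3 (λ n m k → (n :* m) :* k := (n :* k) :* m) refl n (m′ ℕ.* m′) (k′ ℕ.* k′) ⟩
    (n ℕ.* (k′ ℕ.* k′)) ℕ.* (m′ ℕ.* m′)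
      <⟨ ℕ.*-monoˡ-< (m′ ℕ.* m′) (⌊√⌋-upper (n ℕ.* (k′ ℕ.* k′))) ⟩
    (b ℕ.* b) ℕ.* (m′ ℕ.* m′)             ≡⟨ square-* b m′ ⟨
    (b ℕ.* m′) ℕ.* (b ℕ.* m′)             ∎)
    where
    open ℕ.≤-Reasoning
    open +-*-Solver
    m′ = suc m
    k′ = suc k
    a = ⌊√ n ℕ.* (m′ ℕ.* m′) ⌋
    b = suc ⌊√ n ℕ.* (k′ ℕ.* k′) ⌋
    square-* : ∀ p q → (p ℕ.* q) ℕ.* (p ℕ.* q) ≡ (p ℕ.* p) ℕ.* (q ℕ.* q)
    square-* = solve 2 (λ p q → (p :* q) :* (p :* q) := (p :* p) :* (q :* q)) refl

  /-≃ : ∀ a m → ℚ.toℚᵘ (+ a / suc m) ℚᵘ.≃ ℚᵘ.mkℚᵘ (+ a) m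
  /-≃ a m = ℚ.toℚᵘ-fromℚᵘ (ℚᵘ.mkℚᵘ (+ a) m)

  /-mono-< : ∀ a b m k → a ℕ.* suc k ℕ.< b ℕ.* suc m → (+ a / suc m) ℚ.< (+ b / suc k)
  /-mono-< a b m k a<b = ℚ.toℚᵘ-cancel-< (ℚᵘ.<-respˡ-≃ (ℚᵘ.≃-sym (/-≃ a m))
    (ℚᵘ.<-respʳ-≃ (ℚᵘ.≃-sym (/-≃ b k))
      (ℚᵘ.*<* (subst₂ ℤ._<_ (ℤ.pos-* a (suc k)) (ℤ.pos-* b (suc m)) (+<+ a<b)))))

  /-mono-≤ : ∀ a b m k → a ℕ.* suc k ℕ.≤ b ℕ.* suc m → (+ a / suc m) ℚ.≤ (+ b / suc k)
  /-mono-≤ a b m k a≤b = ℚ.toℚᵘ-cancel-≤ (ℚᵘ.≤-respˡ-≃ (ℚᵘ.≃-sym (/-≃ a m))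
    (ℚᵘ.≤-respʳ-≃ (ℚᵘ.≃-sym (/-≃ b k))
      (ℚᵘ.*≤* (subst₂ ℤ._≤_ (ℤ.pos-* a (suc k)) (ℤ.pos-* b (suc m)) (+≤+ a≤b)))))

  /-suc : ∀ a k → + suc a / suc k ≡ (+ a / suc k) ℚ.+ (+ 1 / suc k)
  /-suc a k = ℚ.toℚᵘ-injective (ℚᵘ.≃-trans (/-≃ (suc a) k) (ℚᵘ.≃-sym
    (ℚᵘ.≃-trans (ℚ.toℚᵘ-homo-+ (+ a / suc k) (+ 1 / suc k))
      (ℚᵘ.≃-trans (ℚᵘ.+-cong (/-≃ a k) (/-≃ 1 k)) (ℚᵘ.*≡* eq)))))
    where
    open ℤSolver.+-*-Solver
    eq : (+ a ℤ.* + suc k ℤ.+ + 1 ℤ.* + suc k) ℤ.* + suc k ≡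
         + suc a ℤ.* (+ suc k ℤ.* + suc k)
    eq = solve 2 (λ x y → (x :* y :+ con (+ 1) :* y) :* y := (con (+ 1) :+ x) :* (y :* y))
           refl (+ a) (+ suc k)

  archimedean : ∀ ε → 0ℚ ℚ.< ε → ∃[ N ] (+ 1 / suc N) ℚ.< ε
  archimedean ε@(mkℚ (+ suc a) d _) _ = suc d ,
    subst ((+ 1 / suc (suc d)) ℚ.<_) (ℚ.↥p/↧p≡p ε)
      (/-mono-< 1 (suc a) (suc d) d
        (subst (ℕ._< suc a ℕ.* suc (suc d)) (sym (ℕ.*-identityˡ (suc d)))
          (ℕ.m≤m+n (suc (suc d)) (a ℕ.* suc (suc d)))))
  archimedean (mkℚ (+ zero) _ _)  (*<* (+<+ ()))
  archimedean (mkℚ -[1+ _ ] _ _) (*<* ())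

  √-cauchy : ∀ n → Cauchy (√-approx n)
  √-cauchy n ε ε>0 with archimedean ε ε>0
  ... | N , 1/N<ε = N , λ m k N≤m N≤k →
    ℚ.≤-<-trans (∣p-q∣≤ (half m k N≤k) (half k m N≤m)) 1/N<ε
    where
    open ℚ.≤-Reasoning
    r : ℕ → ℕ
    r i = ⌊√ n ℕ.* (suc i ℕ.* suc i) ⌋
    half : ∀ m k → N ℕ.≤ k → √-approx n m ℚ.≤ √-approx n k ℚ.+ (+ 1 / suc N)
    half m k N≤k = begin
      √-approx n m                            <⟨ /-mono-< (r m) (suc (r k)) m k (cross n m k) ⟩
      + suc (r k) / suc k                     ≡⟨ /-suc (r k) k ⟩
      √-approx n k ℚ.+ (+ 1 / suc k)
        ≤⟨ ℚ.+-monoʳ-≤ (√-approx n k) (/-mono-≤ 1 1 k N (ℕ.*-monoʳ-≤ 1 (ℕ.s≤s N≤k))) ⟩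
      √-approx n k ℚ.+ (+ 1 / suc N)          ∎

open √Lemmas

√ : ℕ → ℝ
√ n = mkℝ (√-approx n) (√-cauchy n)

-- m = min {f a | P a}, with the minimum attained.
IsMinimum : {A B : Set} → Rel B 0ℓ → Rel B 0ℓ → (A → Set) → (A → B) → B → Set
IsMinimum _≈_ _≤_ P f m = (∃[ a ] (P a × f a ≈ m)) × (∀ a → P a → m ≤ f a)

record Graph (n : ℕ) : Set₁ where
  infix 4 _~_ _~?_
  field
    _~_      : Rel (Fin n) 0ℓ
    ~-sym    : Symmetric _~_
    ~-irrefl : Irreflexive _≡_ _~_
    _~?_     : Decidable _~_

-- The value at denominator 0 is a convention; it is never reached in a connected
-- graph with at least two vertices, where every degree is positive.
_/₀_ : ℕ → ℕ → ℚ
p /₀ zero  = 0ℚ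
p /₀ suc q = + p / suc q

-- Starting from 0 is harmless, as only nonnegative reals are compared.
max : List ℝ → ℝ
max = foldr _⊔ℝ_ 0ℝ

‖_‖∞ : ∀ {n} → (Fin n → ℝ) → ℝ
‖ x ‖∞ = max (map (λ v → ∣ x v ∣ℝ) (allFin _))

𝓕 : ∀ {n} → (Fin n → ℝ) → Set
𝓕 x = foldr _+ℝ_ 0ℝ (map x (allFin _)) ≃ℝ 0ℝ × ‖ x ‖∞ ≃ℝ 1ℝ

module _ {n : ℕ} (G : Graph n) where
  open Graph G

  -- Each edge is listed once, with its smaller endpoint first.
  edges : List (Fin n × Fin n)
  edges = filter (λ (u , v) → (u Fin.<? v) ×-dec (u ~? v))
                 (cartesianProduct (allFin n) (allFin n))

  degree : Fin n → ℕ
  degree u = length (filter (u ~?_) (allFin n))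

  Connected : Set
  Connected = ∀ u v → Star _~_ u v

  Regular : ℕ → Set
  Regular k = ∀ v → degree v ≡ k

  vol : Subset n → ℕ
  vol S = sum (map degree (filter (_∈? S) (allFin n)))

  ∂ : Subset n → List (Fin n × Fin n)
  ∂ S = filter (λ (u , v) → ((u ∈? S) ×-dec ¬? (v ∈? S)) ⊎-dec (¬? (u ∈? S) ×-dec (v ∈? S)))
               edges

  cheegerRatio : Subset n → ℚ
  cheegerRatio S = length (∂ S) /₀ (vol S ℕ.⊓ vol (∁ S))

  IsCheegerConstant : ℚ → Set
  IsCheegerConstant = IsMinimum _≡_ ℚ._≤_ (λ S → Nonempty S × S ⊂ ⊤) cheegerRatio

  γ⟨_⟩ : (Fin n → ℝ) → ℝ
  γ⟨ x ⟩ = max (map (λ (u , v) → ∣ x u -ℝ x v ∣ℝ) edges)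

  Isγ : ℝ → Set
  Isγ = IsMinimum _≃ℝ_ _≤ℝ_ 𝓕 γ⟨_⟩

{-# OPTIONS --safe #-}

-- Let x attain γ, let t be a median of x and y = x - t. Applying the co-area inequality to the
-- positive and negative parts of y, each supported on at most half of the vertices, and to their
-- squares gives
--   h k ∑ |y| ≤ ∑_{uv ∈ E} |x_u - x_v| ≤ γ n k / 2   and   h k ∑ y² ≤ γ k ∑ |y|,
-- so 2 h² ∑ y² ≤ n γ². As x has mean 0 and some entry ±1, Cauchy-Schwarz gives ∑ y² ≥ n / (n - 1).
-- Hence 2 h² ≤ (n - 1) γ², a factor 2 better than required; since h > 0 by connectivity, this
-- slack absorbs the errors made on replacing x by rational approximations, which after clearing
-- denominators take values in ℕ.
module Submission where

open import Defs
open import Data.Fin using (Fin; zero; suc)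
import Data.Integer as ℤ
import Data.Integer.Properties as ℤ
open import Data.List using (List; []; _∷_; map; filter; foldr; length; allFin; tabulate; cartesianProduct; _++_)
open import Data.List.Properties using (map-++; map-∘; map-cong; map-tabulate)
import Data.List.Membership.Propositional as List
open import Data.List.Membership.Propositional.Properties
  using (∈-filter⁺; ∈-allFin; ∈-cartesianProduct⁺; ∈-length; ∈-map⁺; ∈-map⁻)
open import Data.Product using (_×_; _,_; ∃-syntax; Σ-syntax; proj₁; proj₂)
open import Data.Sum using (_⊎_; inj₁; inj₂; [_,_]′)
open import Function using (_∘_; id)
open import Relation.Binary.PropositionalEquality
open import Relation.Nullary using (¬_; Dec; yes; no; does; contradiction)
open CauchyLemmas
open √Lemmas

-- Order is undecidable on Cauchy reals, so neither a median of `x` nor an entry of absolute value 1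
-- can be picked from `x` itself. Each index `m` is therefore a separate finite problem about the
-- rationals `seq (x v) m`, with its own large entry `w` and its own median; only the resulting
-- inequality has to be uniform in `m`. As `<ℝ` demands one rational gap valid for all large
-- indices, a non-strict bound at each index would not suffice.
--
-- Natural numbers suit the finite problem: truncated subtraction `a ∸ t` and `t ∸ a` are the
-- positive and negative parts of `a - t`, layers can be removed one unit at a time, and the median
-- is found by counting down. The integer inequality is homogeneous and translation invariant, so
-- that shifting and scaling a rational vector into `ℕ` costs nothing.

module Discrete where

  open import Data.Bool using (true; false; if_then_else_)
  import Data.Fin as Fin
  import Data.Fin.Properties as Fin
  open import Data.Fin.Subset using (Subset; _∈_; _∉_; _⊂_; Nonempty; ⊤; ∁)
  open import Data.Fin.Subset.Properties using (_∈?_; ∈⊤; x∈∁p⇒x∉p; x∉p⇒x∈∁p)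
  open import Data.Nat
  open import Data.Nat.ListAction using () renaming (sum to sumₗ)
  open import Data.Nat.ListAction.Properties using (sum-++)
  open import Data.Nat.Properties
  open import Algebra.Properties.Semiring.Sum +-*-semiring
  open import Data.Nat.Solver using (module +-*-Solver)
  open import Data.Rational using (ℚ; 0ℚ; mkℚ; ↥_; ↧ₙ_)
  import Data.Rational as ℚ
  import Data.Rational.Properties as ℚ
  import Data.Rational.Unnormalised.Properties as ℚᵘ
  import Data.Vec as Vec
  open import Data.Vec.Functional using (removeAt)
  open import Level using (0ℓ)
  open import Relation.Binary.Construct.Closure.ReflexiveTransitive using (Star; ε; _◅_)
  open import Relation.Binary.Definitions using (tri<; tri≈; tri>)
  open import Relation.Nullary.Decidable using (¬?; dec-true; dec-false; decidable-stable; _×-dec_; _⊎-dec_)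
  open import Relation.Unary using (Pred; Decidable)

  -- Finite sums of natural numbers and Cauchy-Schwarz

  sum-mono-≤ : ∀ {n} {f g : Fin n → ℕ} → (∀ i → f i ≤ g i) → sum f ≤ sum g
  sum-mono-≤ {zero}  f≤g = z≤n
  sum-mono-≤ {suc n} f≤g = +-mono-≤ (f≤g zero) (sum-mono-≤ (f≤g ∘ suc))

  sum-const : ∀ n c → ∑[ i < n ] c ≡ n * c
  sum-const zero    c = refl
  sum-const (suc n) c = cong (c +_) (sum-const n c)

  term≤sum : ∀ {n} (f : Fin n → ℕ) i → f i ≤ sum f
  term≤sum f zero    = m≤m+n _ _
  term≤sum f (suc i) = m≤n⇒m≤o+n (f zero) (term≤sum (f ∘ suc) i)

  sum-∣-∣ : ∀ {n} (f g : Fin n → ℕ) → ∣ sum f - sum g ∣ ≤ ∑[ i < n ] ∣ f i - g i ∣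
  sum-∣-∣ {zero}  f g = z≤n
  sum-∣-∣ {suc n} f g = ≤-trans (∣+-+∣ (f zero) (g zero) _ _)
    (+-monoʳ-≤ ∣ f zero - g zero ∣ (sum-∣-∣ (f ∘ suc) (g ∘ suc)))
    where
    ∣+-+∣ : ∀ a b c d → ∣ a + c - b + d ∣ ≤ ∣ a - b ∣ + ∣ c - d ∣
    ∣+-+∣ a b c d = begin
      ∣ a + c - b + d ∣                         ≤⟨ ∣-∣-triangle (a + c) (b + c) (b + d) ⟩
      ∣ a + c - b + c ∣ + ∣ b + c - b + d ∣
        ≡⟨ cong₂ _+_ (trans (cong₂ ∣_-_∣ (+-comm a c) (+-comm b c)) (∣m+n-m+o∣≡∣n-o∣ c a b))
                     (∣m+n-m+o∣≡∣n-o∣ b c d) ⟩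
      ∣ a - b ∣ + ∣ c - d ∣                     ∎
      where open ≤-Reasoning

  ∑∑-distrib-+ : ∀ {m n} (f g : Fin m → Fin n → ℕ) →
    ∑[ u < m ] ∑[ v < n ] (f u v + g u v) ≡ ∑[ u < m ] ∑[ v < n ] f u v + ∑[ u < m ] ∑[ v < n ] g u v
  ∑∑-distrib-+ f g = trans (sum-cong-≗ (λ u → ∑-distrib-+ (f u) (g u)))
                             (∑-distrib-+ (λ u → sum (f u)) (λ u → sum (g u)))

  *-distribˡ-∑∑ : ∀ {m n} g (f : Fin m → Fin n → ℕ) →
    g * ∑[ u < m ] ∑[ v < n ] f u v ≡ ∑[ u < m ] ∑[ v < n ] (g * f u v)
  *-distribˡ-∑∑ g f = trans (*-distribˡ-sum g (λ u → sum (f u)))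
                            (sum-cong-≗ (λ u → *-distribˡ-sum g (f u)))

  -- With `d` the distance between `x` and `y`, the slack is `d * d`; splitting on the order of `x`
  -- and `y` keeps this inside `ℕ`.
  2xy≤x²+y² : ∀ x y → 2 * (x * y) ≤ x * x + y * y
  2xy≤x²+y² x y with ≤-total x y
  ... | inj₁ x≤y with d , refl ← m≤n⇒∃[o]m+o≡n x≤y = begin
      2 * (x * (x + d))
        ≤⟨ m≤m+n _ (d * d) ⟩
      2 * (x * (x + d)) + d * d
        ≡⟨ solve 2 (λ x d → con 2 :* (x :* (x :+ d)) :+ d :* d := x :* x :+ (x :+ d) :* (x :+ d)) refl x d ⟩
      x * x + (x + d) * (x + d) ∎
      where open ≤-Reasoning
            open +-*-Solver
  ... | inj₂ y≤x with d , refl ← m≤n⇒∃[o]m+o≡n y≤x = begin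
      2 * ((y + d) * y)
        ≤⟨ m≤m+n _ (d * d) ⟩
      2 * ((y + d) * y) + d * d
        ≡⟨ solve 2 (λ y d → con 2 :* ((y :+ d) :* y) :+ d :* d := (y :+ d) :* (y :+ d) :+ y :* y) refl y d ⟩
      (y + d) * (y + d) + y * y ∎
      where open ≤-Reasoning
            open +-*-Solver

  -- Cauchy-Schwarz against the constant vector. In the induction the cross term `2 * (x * Y)` is
  -- spread over the `n` remaining entries, each of which pays for one `x * x` and its own square.
  sum²≤n*sum² : ∀ {n} (f : Fin n → ℕ) → sum f * sum f ≤ n * ∑[ i < n ] (f i * f i)
  sum²≤n*sum² {zero}  f = z≤n
  sum²≤n*sum² {suc n} f = begin
    (x + Y) * (x + Y)
      ≡⟨ solve 2 (λ x y → (x :+ y) :* (x :+ y) := x :* x :+ con 2 :* (x :* y) :+ y :* y) refl x Y ⟩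
    x * x + 2 * (x * Y) + Y * Y
      ≤⟨ +-mono-≤ (+-monoʳ-≤ (x * x) cross-terms) (sum²≤n*sum² (f ∘ suc)) ⟩
    x * x + (n * (x * x) + S) + n * S
      ≡⟨ solve 3 (λ x² n S → x² :+ (n :* x² :+ S) :+ n :* S := (con 1 :+ n) :* (x² :+ S)) refl (x * x) n S ⟩
    suc n * (x * x + S) ∎
    where
    open ≤-Reasoning
    open +-*-Solver
    x = f zero
    Y = sum (f ∘ suc)
    S = ∑[ i < n ] (f (suc i) * f (suc i))
    cross-terms : 2 * (x * Y) ≤ n * (x * x) + S
    cross-terms = begin
      2 * (x * Y)                                  ≡⟨ *-assoc 2 x Y ⟨
      2 * x * Y                                    ≡⟨ *-distribˡ-sum (2 * x) (f ∘ suc) ⟩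
      ∑[ i < n ] (2 * x * f (suc i))               ≤⟨ sum-mono-≤ (λ i → ≤-trans (≤-reflexive (*-assoc 2 x _)) (2xy≤x²+y² x (f (suc i)))) ⟩
      ∑[ i < n ] (x * x + f (suc i) * f (suc i))   ≡⟨ ∑-distrib-+ {n} (λ _ → x * x) _ ⟩
      ∑[ i < n ] (x * x) + S                       ≡⟨ cong (_+ S) (sum-const n (x * x)) ⟩
      n * (x * x) + S                              ∎

  -- Cauchy-Schwarz after the vanishing w-th term of ∑ᵤ (p w - p u) has been dropped;
  -- this is what improves n² to n (n - 1).
  deviation²≤ : ∀ {n} (p : Fin n → ℕ) w t → ∣ n * p w - sum p ∣ * ∣ n * p w - sum p ∣ ≤
                n * (n ∸ 1) * ∑[ u < n ] (∣ p u - t ∣ * ∣ p u - t ∣)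
  deviation²≤ {suc m} p w t = begin
    ∣ suc m * p w - sum p ∣ * ∣ suc m * p w - sum p ∣   ≤⟨ *-mono-≤ bound bound ⟩
    (m * α + β) * (m * α + β)
      ≡⟨ solve 3 (λ m a b → (m :* a :+ b) :* (m :* a :+ b) :=
           m :* m :* (a :* a) :+ (m :* (con 2 :* (a :* b)) :+ b :* b)) refl m α β ⟩
    -- This is Cauchy-Schwarz with weights `m` and 1, `(mα + β)² ≤ (m + 1)(mα² + β²)`. The bound
    -- `β² ≤ m S` then makes `(m + 1) m` a common factor.
    m * m * (α * α) + (m * (2 * (α * β)) + β * β)
      ≤⟨ +-monoʳ-≤ (m * m * (α * α)) (+-monoˡ-≤ (β * β) (*-monoʳ-≤ m (2xy≤x²+y² α β))) ⟩
    m * m * (α * α) + (m * (α * α + β * β) + β * β)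
      ≡⟨ solve 3 (λ m a b → m :* m :* a :+ (m :* (a :+ b) :+ b) :=
           (con 1 :+ m) :* m :* a :+ (con 1 :+ m) :* b) refl m (α * α) (β * β) ⟩
    suc m * m * (α * α) + suc m * (β * β)
      ≤⟨ +-monoʳ-≤ (suc m * m * (α * α)) (*-monoʳ-≤ (suc m) (sum²≤n*sum² (removeAt d w))) ⟩
    suc m * m * (α * α) + suc m * (m * S)
      ≡⟨ solve 3 (λ m a s → (con 1 :+ m) :* m :* a :+ (con 1 :+ m) :* (m :* s) :=
           (con 1 :+ m) :* m :* (a :+ s)) refl m (α * α) S ⟩
    suc m * m * (α * α + S)
      ≡⟨ cong (suc m * m *_) (sum-remove {i = w} (λ u → d u * d u)) ⟨
    suc m * m * ∑[ u < suc m ] (d u * d u) ∎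
    where
    open ≤-Reasoning
    open +-*-Solver
    d : Fin (suc m) → ℕ
    d u = ∣ p u - t ∣
    α = d w
    β = sum (removeAt d w)
    S = sum (removeAt (λ u → d u * d u) w)
    bound : ∣ suc m * p w - sum p ∣ ≤ m * α + β
    bound = begin
      ∣ suc m * p w - sum p ∣                    ≡⟨ cong ∣_- sum p ∣ (sum-const (suc m) (p w)) ⟨
      ∣ ∑[ u < suc m ] p w - sum p ∣             ≤⟨ sum-∣-∣ (λ _ → p w) p ⟩
      ∑[ u < suc m ] ∣ p w - p u ∣               ≡⟨ sum-remove {i = w} (λ u → ∣ p w - p u ∣) ⟩
      ∣ p w - p w ∣ + sum (removeAt (λ u → ∣ p w - p u ∣) w)
        ≡⟨ cong (_+ sum (removeAt (λ u → ∣ p w - p u ∣) w)) (∣n-n∣≡0 (p w)) ⟩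
      sum (removeAt (λ u → ∣ p w - p u ∣) w)
        ≤⟨ sum-mono-≤ (λ i → let pᵢ = removeAt p w i in
             ≤-trans (∣-∣-triangle (p w) t pᵢ) (≤-reflexive (cong (α +_) (∣-∣-comm t pᵢ)))) ⟩
      sum (λ i → α + removeAt d w i)             ≡⟨ ∑-distrib-+ {m} (λ _ → α) (removeAt d w) ⟩
      ∑[ i < m ] α + β                           ≡⟨ cong (_+ β) (sum-const m α) ⟩
      m * α + β                                  ∎

  -- Layers, positive and negative parts, medians

  sign : ℕ → ℕ
  sign zero    = 0
  sign (suc _) = 1

  sign+pred : ∀ a → sign a + pred a ≡ a
  sign+pred zero    = refl
  sign+pred (suc a) = refl

  -- `sign` and `pred` are both monotone, so the two differences never have opposite signs and
  -- nothing cancels. This is the co-area formula for a single layer.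
  ∣-∣-sign+pred : ∀ a b → ∣ sign a - sign b ∣ + ∣ pred a - pred b ∣ ≡ ∣ a - b ∣
  ∣-∣-sign+pred zero    zero    = refl
  ∣-∣-sign+pred zero    (suc b) = refl
  ∣-∣-sign+pred (suc a) zero    = cong suc (∣-∣-identityʳ a)
  ∣-∣-sign+pred (suc a) (suc b) = refl

  sign-pred≤ : ∀ a → sign (pred a) ≤ sign a
  sign-pred≤ zero          = z≤n
  sign-pred≤ (suc zero)    = z≤n
  sign-pred≤ (suc (suc a)) = ≤-refl

  sign-sq : ∀ a → sign (a * a) ≡ sign a
  sign-sq zero    = refl
  sign-sq (suc a) = refl

  ∸+∸≡∣-∣ : ∀ a t → (a ∸ t) + (t ∸ a) ≡ ∣ a - t ∣
  ∸+∸≡∣-∣ zero    zero    = refl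
  ∸+∸≡∣-∣ zero    (suc t) = refl
  ∸+∸≡∣-∣ (suc a) zero    = +-identityʳ (suc a)
  ∸+∸≡∣-∣ (suc a) (suc t) = ∸+∸≡∣-∣ a t

  -- As `a` grows, its positive part `a ∸ t` grows and its negative part `t ∸ a` shrinks, so the
  -- changes of the two parts add up to the change of `a` without cancellation.
  ∸-split-∣-∣ : ∀ t a b → ∣ (a ∸ t) - (b ∸ t) ∣ + ∣ (t ∸ a) - (t ∸ b) ∣ ≡ ∣ a - b ∣
  ∸-split-∣-∣ zero    a       b       = trans (cong₂ (λ x y → ∣ a - b ∣ + ∣ x - y ∣) (0∸n≡0 a) (0∸n≡0 b)) (+-identityʳ _)
  ∸-split-∣-∣ (suc t) zero    zero    = ∣n-n∣≡0 t
  ∸-split-∣-∣ (suc t) zero    (suc b) with ≤-total t b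
  ... | inj₁ t≤b rewrite m≤n⇒m∸n≡0 t≤b = trans (+-suc (b ∸ t) t) (cong suc (m∸n+n≡m t≤b))
  ... | inj₂ b≤t = cong₂ _+_ (m≤n⇒m∸n≡0 b≤t) (begin
    ∣ suc t - t ∸ b ∣             ≡⟨ m≤n⇒∣n-m∣≡n∸m (m≤n⇒m≤1+n (m∸n≤m t b)) ⟩
    suc t ∸ (t ∸ b)               ≡⟨ +-∸-assoc 1 (m∸n≤m t b) ⟩
    suc (t ∸ (t ∸ b))             ≡⟨ cong suc (m∸[m∸n]≡n b≤t) ⟩
    suc b                         ∎)
    where open ≡-Reasoning
  ∸-split-∣-∣ (suc t) (suc a) zero    = begin
    ∣ (a ∸ t) - 0 ∣ + ∣ t ∸ a - suc t ∣   ≡⟨ cong₂ _+_ (∣-∣-comm (a ∸ t) 0) (∣-∣-comm (t ∸ a) (suc t)) ⟩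
    (a ∸ t) + ∣ suc t - t ∸ a ∣           ≡⟨ ∸-split-∣-∣ (suc t) zero (suc a) ⟩
    suc a                                 ∎
    where open ≡-Reasoning
  ∸-split-∣-∣ (suc t) (suc a) (suc b) = ∸-split-∣-∣ t a b

  ∣x²-y²∣ : ∀ x y → ∣ x * x - y * y ∣ ≡ ∣ x - y ∣ * (x + y)
  ∣x²-y²∣ x y = begin
    ∣ x * x - y * y ∣                       ≡⟨ ∣m+n-m+o∣≡∣n-o∣ (x * y) (x * x) (y * y) ⟨
    ∣ x * y + x * x - x * y + y * y ∣
      ≡⟨ cong₂ ∣_-_∣ (solve 2 (λ x y → x :* y :+ x :* x := x :* (x :+ y)) refl x y)
                     (solve 2 (λ x y → x :* y :+ y :* y := y :* (x :+ y)) refl x y) ⟩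
    ∣ x * (x + y) - y * (x + y) ∣           ≡⟨ *-distribʳ-∣-∣ (x + y) x y ⟨
    ∣ x - y ∣ * (x + y)                     ∎
    where open ≡-Reasoning
          open +-*-Solver

  -- Each difference of squares factors as difference times sum. Once both sums are enlarged to the
  -- same total, `∣ a - t ∣ + ∣ b - t ∣`, the differences recombine by `∸-split-∣-∣`.
  ∸-split-squares : ∀ t a b →
    ∣ (a ∸ t) * (a ∸ t) - (b ∸ t) * (b ∸ t) ∣ + ∣ (t ∸ a) * (t ∸ a) - (t ∸ b) * (t ∸ b) ∣ ≤
    ∣ a - b ∣ * (∣ a - t ∣ + ∣ b - t ∣)
  ∸-split-squares t a b = begin
    ∣ x * x - y * y ∣ + ∣ x′ * x′ - y′ * y′ ∣
      ≡⟨ cong₂ _+_ (∣x²-y²∣ x y) (∣x²-y²∣ x′ y′) ⟩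
    ∣ x - y ∣ * (x + y) + ∣ x′ - y′ ∣ * (x′ + y′)
      ≤⟨ +-mono-≤ (*-monoʳ-≤ ∣ x - y ∣ (m≤m+n (x + y) (x′ + y′)))
                  (*-monoʳ-≤ ∣ x′ - y′ ∣ (m≤n+m (x′ + y′) (x + y))) ⟩
    ∣ x - y ∣ * (x + y + (x′ + y′)) + ∣ x′ - y′ ∣ * (x + y + (x′ + y′))
      ≡⟨ *-distribʳ-+ (x + y + (x′ + y′)) ∣ x - y ∣ ∣ x′ - y′ ∣ ⟨
    (∣ x - y ∣ + ∣ x′ - y′ ∣) * (x + y + (x′ + y′))
      ≡⟨ cong₂ _*_ (∸-split-∣-∣ t a b)
           (solve 4 (λ x y x′ y′ → x :+ y :+ (x′ :+ y′) := (x :+ x′) :+ (y :+ y′)) refl x y x′ y′) ⟩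
    ∣ a - b ∣ * ((x + x′) + (y + y′))
      ≡⟨ cong (∣ a - b ∣ *_) (cong₂ _+_ (∸+∸≡∣-∣ a t) (∸+∸≡∣-∣ b t)) ⟩
    ∣ a - b ∣ * (∣ a - t ∣ + ∣ b - t ∣) ∎
    where
    open ≤-Reasoning
    open +-*-Solver
    x = a ∸ t
    y = b ∸ t
    x′ = t ∸ a
    y′ = t ∸ b

  -- The dichotomy `t < a` or `a < suc t`, counted by indicators.
  sign-∸ : ∀ a t → sign (a ∸ t) + sign (suc t ∸ a) ≡ 1
  sign-∸ zero    zero    = refl
  sign-∸ zero    (suc t) = refl
  sign-∸ (suc a) zero    = cong (λ x → 1 + sign x) (0∸n≡0 a)
  sign-∸ (suc a) (suc t) = sign-∸ a t

  -- The threshold descends from `sum p`, above which no value lies, for as long as at most half of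
  -- the values lie above the next one. When it stops at `suc t`, more than half lie above `t`, and
  -- the values below `suc t` are exactly the others. At threshold 0 nothing lies below.
  median : ∀ {n} (p : Fin n → ℕ) → ∃[ t ]
    (2 * ∑[ u < n ] sign (p u ∸ t) ≤ n × 2 * ∑[ u < n ] sign (t ∸ p u) ≤ n)
  median {n} p = descend (sum p) none-above
    where
    open ≤-Reasoning
    above below : ℕ → ℕ
    above t = ∑[ u < n ] sign (p u ∸ t)
    below t = ∑[ u < n ] sign (t ∸ p u)
    none-above : 2 * above (sum p) ≤ n
    none-above = begin
      2 * above (sum p)   ≡⟨ cong (2 *_) (sum-cong-≗ (λ u → cong sign (m≤n⇒m∸n≡0 (term≤sum p u)))) ⟩
      2 * ∑[ u < n ] 0    ≡⟨ cong (2 *_) (sum-replicate-zero n) ⟩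
      0                   ≤⟨ z≤n ⟩
      n                   ∎
    above+below : ∀ t → above t + below (suc t) ≡ n
    above+below t = trans (sym (∑-distrib-+ {n} (λ u → sign (p u ∸ t)) _))
      (trans (sum-cong-≗ (λ u → sign-∸ (p u) t)) (trans (sum-const n 1) (*-identityʳ n)))
    descend : ∀ t → 2 * above t ≤ n → ∃[ t ] (2 * above t ≤ n × 2 * below t ≤ n)
    descend zero    few = zero , few , (begin
      2 * below 0        ≡⟨ cong (2 *_) (sum-cong-≗ (λ u → cong sign (0∸n≡0 (p u)))) ⟩
      2 * ∑[ u < n ] 0   ≡⟨ cong (2 *_) (sum-replicate-zero n) ⟩
      0                  ≤⟨ z≤n ⟩
      n                  ∎)
    descend (suc t) few with 2 * above t ≤? n
    ... | yes few′ = descend t few′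
    ... | no  many = suc t , few , +-cancelˡ-≤ n _ _ (begin
      n + 2 * below (suc t)              ≤⟨ +-monoˡ-≤ _ (<⇒≤ (≰⇒> many)) ⟩
      2 * above t + 2 * below (suc t)    ≡⟨ *-distribˡ-+ 2 (above t) _ ⟨
      2 * (above t + below (suc t))      ≡⟨ cong (2 *_) (above+below t) ⟩
      2 * n                              ≡⟨ cong (n +_) (+-identityʳ n) ⟩
      n + n                              ∎)

  -- Co-area inequality and the Cheeger-type bound for weight matrices

  -- a is a symmetric weight matrix with all row sums k. As ordered pairs are summed over,
  -- variation (sign ∘ z) is twice the weight of the boundary of {z > 0}, so the hypothesis
  -- isoperimetry reads A / B ≤ |∂S| / vol S.
  module Isoperimetry {n k A B : ℕ} (a : Fin n → Fin n → ℕ) (a-sym : ∀ u v → a u v ≡ a v u)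
                      (row-sum : ∀ u → sum (a u) ≡ k) where

    variation : (Fin n → ℕ) → ℕ
    variation z = ∑[ u < n ] ∑[ v < n ] (a u v * ∣ z u - z v ∣)

    -- Additivity over layers is what lets an inequality for sets pass to functions: `sign ∘ z` is
    -- the indicator of the bottom layer and `pred ∘ z` is what lies above it.
    variation-layers : ∀ z → variation z ≡ variation (sign ∘ z) + variation (pred ∘ z)
    variation-layers z = trans
      (sum-cong-≗ λ u → sum-cong-≗ λ v →
        trans (cong (a u v *_) (sym (∣-∣-sign+pred (z u) (z v)))) (*-distribˡ-+ (a u v) _ _))
      (∑∑-distrib-+ {n} {n} _ _)

    weighted-row : ∀ (y : Fin n → ℕ) → ∑[ u < n ] ∑[ v < n ] (a u v * y u) ≡ k * sum y
    weighted-row y = begin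
      ∑[ u < n ] ∑[ v < n ] (a u v * y u)   ≡⟨ sum-cong-≗ (λ u → *-distribʳ-sum (y u) (a u)) ⟨
      ∑[ u < n ] (sum (a u) * y u)          ≡⟨ sum-cong-≗ (λ u → cong (_* y u) (row-sum u)) ⟩
      ∑[ u < n ] (k * y u)                  ≡⟨ *-distribˡ-sum k y ⟨
      k * sum y                             ∎
      where open ≡-Reasoning

    weighted-endpoints : ∀ (y : Fin n → ℕ) → ∑[ u < n ] ∑[ v < n ] (a u v * (y u + y v)) ≡ 2 * (k * sum y)
    weighted-endpoints y = begin
      ∑[ u < n ] ∑[ v < n ] (a u v * (y u + y v))
        ≡⟨ (sum-cong-≗ λ u → sum-cong-≗ λ v → *-distribˡ-+ (a u v) (y u) (y v)) ⟩
      ∑[ u < n ] ∑[ v < n ] (a u v * y u + a u v * y v)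
        ≡⟨ ∑∑-distrib-+ {n} {n} _ _ ⟩
      ∑[ u < n ] ∑[ v < n ] (a u v * y u) + ∑[ u < n ] ∑[ v < n ] (a u v * y v)
        ≡⟨ cong₂ _+_ (weighted-row y) (trans (∑-comm (λ u v → a u v * y v))
             (trans (sum-cong-≗ (λ v → sum-cong-≗ λ u → cong (_* y v) (a-sym u v))) (weighted-row y))) ⟩
      k * sum y + k * sum y
        ≡⟨ cong (k * sum y +_) (+-identityʳ _) ⟨
      2 * (k * sum y) ∎
      where open ≡-Reasoning

    module _ (isoperimetry : ∀ z → 2 * ∑[ u < n ] sign (z u) ≤ n →
                2 * (A * (k * ∑[ u < n ] sign (z u))) ≤ B * variation (sign ∘ z)) where

      -- Peels off one layer {z > 0} at a time.
      coarea : ∀ T z → (∀ u → z u ≤ T) → 2 * ∑[ u < n ] sign (z u) ≤ n →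
               2 * (A * (k * sum z)) ≤ B * variation z
      coarea zero z z≤T small = begin
        2 * (A * (k * sum z))          ≡⟨ cong (λ s → 2 * (A * (k * s))) (trans (sum-cong-≗ (n≤0⇒n≡0 ∘ z≤T)) (sum-replicate-zero n)) ⟩
        2 * (A * (k * 0))              ≡⟨ solve 2 (λ A k → con 2 :* (A :* (k :* con 0)) := con 0) refl A k ⟩
        0                              ≤⟨ z≤n ⟩
        B * variation z                ∎
        where open ≤-Reasoning
              open +-*-Solver
      coarea (suc T) z z≤T small = begin
        2 * (A * (k * sum z))
          ≡⟨ cong (λ s → 2 * (A * (k * s))) (trans (sum-cong-≗ (sym ∘ sign+pred ∘ z)) (∑-distrib-+ (sign ∘ z) (pred ∘ z))) ⟩
        2 * (A * (k * (sum (sign ∘ z) + sum (pred ∘ z))))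
          ≡⟨ solve 4 (λ A k s t → con 2 :* (A :* (k :* (s :+ t))) := con 2 :* (A :* (k :* s)) :+ con 2 :* (A :* (k :* t)))
               refl A k (sum (sign ∘ z)) (sum (pred ∘ z)) ⟩
        2 * (A * (k * sum (sign ∘ z))) + 2 * (A * (k * sum (pred ∘ z)))
          ≤⟨ +-mono-≤ (isoperimetry z small)
               (coarea T (pred ∘ z) (pred-mono-≤ ∘ z≤T)
                 (≤-trans (*-monoʳ-≤ 2 (sum-mono-≤ (sign-pred≤ ∘ z))) small)) ⟩
        B * variation (sign ∘ z) + B * variation (pred ∘ z)
          ≡⟨ *-distribˡ-+ B _ _ ⟨
        B * (variation (sign ∘ z) + variation (pred ∘ z))
          ≡⟨ cong (B *_) (variation-layers z) ⟨
        B * variation z ∎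
        where open ≤-Reasoning
              open +-*-Solver

      coarea₂ : ∀ z z′ → 2 * ∑[ u < n ] sign (z u) ≤ n → 2 * ∑[ u < n ] sign (z′ u) ≤ n →
                2 * (A * (k * ∑[ u < n ] (z u + z′ u))) ≤
                B * ∑[ u < n ] ∑[ v < n ] (a u v * (∣ z u - z v ∣ + ∣ z′ u - z′ v ∣))
      coarea₂ z z′ small small′ = begin
        2 * (A * (k * ∑[ u < n ] (z u + z′ u)))
          ≡⟨ cong (λ s → 2 * (A * (k * s))) (∑-distrib-+ z z′) ⟩
        2 * (A * (k * (sum z + sum z′)))
          ≡⟨ solve 4 (λ A k s t → con 2 :* (A :* (k :* (s :+ t))) := con 2 :* (A :* (k :* s)) :+ con 2 :* (A :* (k :* t)))
               refl A k (sum z) (sum z′) ⟩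
        2 * (A * (k * sum z)) + 2 * (A * (k * sum z′))
          -- Any common upper bound of the values may serve as the number of layers; the sum is one.
          ≤⟨ +-mono-≤ (coarea (sum z) z (term≤sum z) small) (coarea (sum z′) z′ (term≤sum z′) small′) ⟩
        B * variation z + B * variation z′
          ≡⟨ *-distribˡ-+ B _ _ ⟨
        B * (variation z + variation z′)
          ≡⟨ cong (B *_) (∑∑-distrib-+ {n} {n} _ _) ⟨
        B * ∑[ u < n ] ∑[ v < n ] (a u v * ∣ z u - z v ∣ + a u v * ∣ z′ u - z′ v ∣)
          ≡⟨ cong (B *_) (sum-cong-≗ λ u → sum-cong-≗ λ v → *-distribˡ-+ (a u v) _ _) ⟨
        B * ∑[ u < n ] ∑[ v < n ] (a u v * (∣ z u - z v ∣ + ∣ z′ u - z′ v ∣)) ∎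
        where open ≤-Reasoning
              open +-*-Solver

      module _ .{{_ : NonZero k}} (p : Fin n → ℕ) (g : ℕ) (steps≤ : ∀ u v → a u v * ∣ p u - p v ∣ ≤ a u v * g)
               (t : ℕ) (few-above : 2 * ∑[ u < n ] sign (p u ∸ t) ≤ n)
               (few-below : 2 * ∑[ u < n ] sign (t ∸ p u) ≤ n) where

        y : Fin n → ℕ
        y u = ∣ p u - t ∣

        linear-bound : 2 * (A * sum y) ≤ B * (g * n)
        linear-bound = *-cancelˡ-≤ k (begin
          k * (2 * (A * sum y))
            ≡⟨ solve 3 (λ k A s → k :* (con 2 :* (A :* s)) := con 2 :* (A :* (k :* s))) refl k A (sum y) ⟩
          2 * (A * (k * sum y))
            ≡⟨ cong (λ s → 2 * (A * (k * s))) (sum-cong-≗ (λ u → ∸+∸≡∣-∣ (p u) t)) ⟨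
          2 * (A * (k * ∑[ u < n ] ((p u ∸ t) + (t ∸ p u))))
            ≤⟨ coarea₂ (λ u → p u ∸ t) (λ u → t ∸ p u) few-above few-below ⟩
          B * ∑[ u < n ] ∑[ v < n ] (a u v * (∣ (p u ∸ t) - (p v ∸ t) ∣ + ∣ (t ∸ p u) - (t ∸ p v) ∣))
            ≤⟨ *-monoʳ-≤ B (sum-mono-≤ λ u → sum-mono-≤ λ v →
                 ≤-trans (≤-reflexive (cong (a u v *_) (∸-split-∣-∣ t (p u) (p v)))) (steps≤ u v)) ⟩
          B * ∑[ u < n ] ∑[ v < n ] (a u v * g)
            ≡⟨ cong (B *_) (trans (weighted-row (λ _ → g)) (cong (k *_) (sum-const n g))) ⟩
          B * (k * (n * g))
            ≡⟨ solve 4 (λ B k n g → B :* (k :* (n :* g)) := k :* (B :* (g :* n))) refl B k n g ⟩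
          k * (B * (g * n)) ∎)
          where open ≤-Reasoning
                open +-*-Solver

        small-squares : ∀ {z} → 2 * ∑[ u < n ] sign (z u) ≤ n → 2 * ∑[ u < n ] sign (z u * z u) ≤ n
        small-squares {z} = ≤-trans (≤-reflexive (cong (2 *_) (sum-cong-≗ (sign-sq ∘ z))))

        quadratic-bound : A * ∑[ u < n ] (y u * y u) ≤ B * (g * sum y)
        quadratic-bound = *-cancelˡ-≤ (2 * k) {{m*n≢0 2 k}} (begin
          2 * k * (A * ∑[ u < n ] (y u * y u))
            ≡⟨ solve 3 (λ k A s → con 2 :* k :* (A :* s) := con 2 :* (A :* (k :* s))) refl k A _ ⟩
          2 * (A * (k * ∑[ u < n ] (y u * y u)))
            ≡⟨ cong (λ s → 2 * (A * (k * s))) (sum-cong-≗ (λ u → squares (p u))) ⟩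
          2 * (A * (k * ∑[ u < n ] ((p u ∸ t) * (p u ∸ t) + (t ∸ p u) * (t ∸ p u))))
            ≤⟨ coarea₂ _ _ (small-squares {λ u → p u ∸ t} few-above) (small-squares {λ u → t ∸ p u} few-below) ⟩
          B * ∑[ u < n ] ∑[ v < n ] (a u v *
            (∣ (p u ∸ t) * (p u ∸ t) - (p v ∸ t) * (p v ∸ t) ∣ + ∣ (t ∸ p u) * (t ∸ p u) - (t ∸ p v) * (t ∸ p v) ∣))
            -- On an edge a square changes by at most `g` times `y u + y v`; each vertex then
            -- collects its `y` once per incident weight, in both orders, whence the factor `2 * k`.
            ≤⟨ *-monoʳ-≤ B (sum-mono-≤ λ u → sum-mono-≤ λ v → edge u v) ⟩
          B * ∑[ u < n ] ∑[ v < n ] (g * (a u v * (y u + y v)))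
            ≡⟨ cong (B *_) (trans (sym (*-distribˡ-∑∑ g (λ u v → a u v * (y u + y v)))) (cong (g *_) (weighted-endpoints y))) ⟩
          B * (g * (2 * (k * sum y)))
            ≡⟨ solve 4 (λ B g k s → B :* (g :* (con 2 :* (k :* s))) := con 2 :* k :* (B :* (g :* s))) refl B g k (sum y) ⟩
          2 * k * (B * (g * sum y)) ∎)
          where
          open ≤-Reasoning
          open +-*-Solver
          squares : ∀ x → ∣ x - t ∣ * ∣ x - t ∣ ≡ (x ∸ t) * (x ∸ t) + (t ∸ x) * (t ∸ x)
          squares x with ≤-total x t
          ... | inj₁ x≤t rewrite m≤n⇒m∸n≡0 x≤t | m≤n⇒∣m-n∣≡n∸m x≤t = refl
          ... | inj₂ t≤x rewrite m≤n⇒m∸n≡0 t≤x | m≤n⇒∣n-m∣≡n∸m t≤x = sym (+-identityʳ _)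
          edge : ∀ u v → a u v * (∣ (p u ∸ t) * (p u ∸ t) - (p v ∸ t) * (p v ∸ t) ∣ +
                                  ∣ (t ∸ p u) * (t ∸ p u) - (t ∸ p v) * (t ∸ p v) ∣) ≤
                         g * (a u v * (y u + y v))
          edge u v = begin
            a u v * _                                  ≤⟨ *-monoʳ-≤ (a u v) (∸-split-squares t (p u) (p v)) ⟩
            a u v * (∣ p u - p v ∣ * (y u + y v))      ≡⟨ *-assoc (a u v) _ _ ⟨
            a u v * ∣ p u - p v ∣ * (y u + y v)        ≤⟨ *-monoˡ-≤ (y u + y v) (steps≤ u v) ⟩
            a u v * g * (y u + y v)
              ≡⟨ solve 3 (λ a g y → a :* g :* y := g :* (a :* y)) refl (a u v) g (y u + y v) ⟩
            g * (a u v * (y u + y v))                  ∎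

        cheeger-steps : 2 * (A * A * ∑[ u < n ] (y u * y u)) ≤ B * B * (g * g) * n
        cheeger-steps = begin
          2 * (A * A * s₂)
            ≡⟨ solve 2 (λ A s → con 2 :* (A :* A :* s) := con 2 :* (A :* (A :* s))) refl A s₂ ⟩
          2 * (A * (A * s₂))
            ≤⟨ *-monoʳ-≤ 2 (*-monoʳ-≤ A quadratic-bound) ⟩
          2 * (A * (B * (g * s₁)))
            ≡⟨ solve 4 (λ A B g s → con 2 :* (A :* (B :* (g :* s))) := B :* g :* (con 2 :* (A :* s))) refl A B g s₁ ⟩
          B * g * (2 * (A * s₁))
            ≤⟨ *-monoʳ-≤ (B * g) linear-bound ⟩
          B * g * (B * (g * n))
            ≡⟨ solve 3 (λ B g n → B :* g :* (B :* (g :* n)) := B :* B :* (g :* g) :* n) refl B g n ⟩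
          B * B * (g * g) * n ∎
          where
          open ≤-Reasoning
          open +-*-Solver
          s₁ = sum y
          s₂ = ∑[ u < n ] (y u * y u)

      -- `∣ n * p w - sum p ∣` is `n` times the distance of `p w` from the mean, so the inequality
      -- does not change when `p` is translated and scales evenly when `p` and `g` are multiplied
      -- together. Mean 0 and norm 1 enter only later. The weight `a u v` on both sides of the step
      -- hypothesis confines it to edges.
      integer-bound : .{{_ : NonZero k}} → ∀ p g → (∀ u v → a u v * ∣ p u - p v ∣ ≤ a u v * g) → ∀ w →
        2 * (A * A * (∣ n * p w - sum p ∣ * ∣ n * p w - sum p ∣)) ≤ n * n * (n ∸ 1) * (B * B * (g * g))
      integer-bound p g steps≤ w with t , few-above , few-below ← median p = begin
        2 * (A * A * (e * e))
          ≤⟨ *-monoʳ-≤ 2 (*-monoʳ-≤ (A * A) (deviation²≤ p w t)) ⟩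
        2 * (A * A * (n * (n ∸ 1) * s₂))
          ≡⟨ solve 3 (λ A² c s → con 2 :* (A² :* (c :* s)) := c :* (con 2 :* (A² :* s))) refl (A * A) (n * (n ∸ 1)) s₂ ⟩
        n * (n ∸ 1) * (2 * (A * A * s₂))
          ≤⟨ *-monoʳ-≤ (n * (n ∸ 1)) (cheeger-steps p g steps≤ t few-above few-below) ⟩
        n * (n ∸ 1) * (B * B * (g * g) * n)
          ≡⟨ solve 3 (λ n m c → n :* m :* (c :* n) := n :* n :* m :* c) refl n (n ∸ 1) (B * B * (g * g)) ⟩
        n * n * (n ∸ 1) * (B * B * (g * g)) ∎
        where
        open ≤-Reasoning
        open +-*-Solver
        e = ∣ n * p w - sum p ∣
        s₂ = ∑[ u < n ] (∣ p u - t ∣ * ∣ p u - t ∣)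

  -- Counting in filtered lists by sums of indicators

  indicator : ∀ {P : Set} → Dec P → ℕ
  indicator P? = if does P? then 1 else 0

  indicator-true : ∀ {P : Set} (P? : Dec P) → P → indicator P? ≡ 1
  indicator-true P? p rewrite dec-true P? p = refl

  indicator-false : ∀ {P : Set} (P? : Dec P) → ¬ P → indicator P? ≡ 0
  indicator-false P? ¬p rewrite dec-false P? ¬p = refl

  indicator-*-≤ : ∀ {P Q : Set} (P? : Dec P) (Q? : Dec Q) {m} →
                  (P → Q → m ≡ 1) → indicator P? * indicator Q? ≤ m
  indicator-*-≤ (yes p) (yes q) m≡1 = ≤-reflexive (sym (m≡1 p q))
  indicator-*-≤ (yes p) (no _)  m≡1 = z≤n
  indicator-*-≤ (no _)  _       m≡1 = z≤n

  module _ {A : Set} where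

    length≡sum : (xs : List A) → length xs ≡ sumₗ (map (λ _ → 1) xs)
    length≡sum []       = refl
    length≡sum (x ∷ xs) = cong suc (length≡sum xs)

    sum-map-filter : ∀ {P : Pred A 0ℓ} (P? : Decidable P) f xs →
      sumₗ (map f (filter P? xs)) ≡ sumₗ (map (λ x → indicator (P? x) * f x) xs)
    sum-map-filter P? f []       = refl
    sum-map-filter P? f (x ∷ xs) with does (P? x)
    ... | true  = cong₂ _+_ (sym (+-identityʳ (f x))) (sum-map-filter P? f xs)
    ... | false = sum-map-filter P? f xs

    length-filter-filter : ∀ {P Q : Pred A 0ℓ} (P? : Decidable P) (Q? : Decidable Q) xs →
      length (filter Q? (filter P? xs)) ≡ sumₗ (map (λ x → indicator (P? x) * indicator (Q? x)) xs)
    length-filter-filter P? Q? xs = begin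
      length (filter Q? (filter P? xs))
        ≡⟨ length≡sum (filter Q? (filter P? xs)) ⟩
      sumₗ (map (λ _ → 1) (filter Q? (filter P? xs)))
        ≡⟨ sum-map-filter Q? _ (filter P? xs) ⟩
      sumₗ (map (λ x → indicator (Q? x) * 1) (filter P? xs))
        ≡⟨ sum-map-filter P? _ xs ⟩
      sumₗ (map (λ x → indicator (P? x) * (indicator (Q? x) * 1)) xs)
        ≡⟨ cong sumₗ (map-cong (λ x → cong (indicator (P? x) *_) (*-identityʳ _)) xs) ⟩
      sumₗ (map (λ x → indicator (P? x) * indicator (Q? x)) xs) ∎
      where open ≡-Reasoning

    sum-map-cartesianProduct : ∀ {B : Set} (f : A × B → ℕ) xs ys →
      sumₗ (map f (cartesianProduct xs ys)) ≡ sumₗ (map (λ x → sumₗ (map (λ y → f (x , y)) ys)) xs)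
    sum-map-cartesianProduct f []       ys = refl
    sum-map-cartesianProduct f (x ∷ xs) ys = begin
      sumₗ (map f (map (x ,_) ys ++ cartesianProduct xs ys))
        ≡⟨ cong sumₗ (map-++ f (map (x ,_) ys) _) ⟩
      sumₗ (map f (map (x ,_) ys) ++ map f (cartesianProduct xs ys))
        ≡⟨ sum-++ (map f (map (x ,_) ys)) _ ⟩
      sumₗ (map f (map (x ,_) ys)) + sumₗ (map f (cartesianProduct xs ys))
        ≡⟨ cong₂ _+_ (cong sumₗ (sym (map-∘ ys))) (sum-map-cartesianProduct f xs ys) ⟩
      sumₗ (map (λ y → f (x , y)) ys) + _ ∎
      where open ≡-Reasoning

  sum-map-allFin : ∀ {n} (f : Fin n → ℕ) → sumₗ (map f (allFin n)) ≡ sum f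
  sum-map-allFin f = trans (cong sumₗ (map-tabulate (λ i → i) f)) (sum-tabulate f)
    where
    sum-tabulate : ∀ {n} (f : Fin n → ℕ) → sumₗ (tabulate f) ≡ sum f
    sum-tabulate {zero}  f = refl
    sum-tabulate {suc n} f = cong (f zero +_) (sum-tabulate (f ∘ suc))

  module _ {n : ℕ} where

    χ : Subset n → Fin n → ℕ
    χ S u = indicator (u ∈? S)

    χ-∁ : ∀ S u → χ S u + χ (∁ S) u ≡ 1
    χ-∁ S u with u ∈? S
    ... | yes u∈S = cong suc (indicator-false (u ∈? ∁ S) (λ u∈∁S → x∈∁p⇒x∉p u∈∁S u∈S))
    ... | no  u∉S = indicator-true (u ∈? ∁ S) (x∉p⇒x∈∁p u∉S)

    sum-χ-∁ : ∀ S → sum (χ S) + sum (χ (∁ S)) ≡ n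
    sum-χ-∁ S = trans (sym (∑-distrib-+ (χ S) (χ (∁ S))))
      (trans (sum-cong-≗ (χ-∁ S)) (trans (sum-const n 1) (*-identityʳ n)))

    nonempty⇒sum-χ>0 : ∀ S → Nonempty S → 0 < sum (χ S)
    nonempty⇒sum-χ>0 S (u , u∈S) = ≤-trans (≤-reflexive (sym (indicator-true (u ∈? S) u∈S))) (term≤sum (χ S) u)

    -- The co-area argument speaks of functions, the Cheeger constant of subsets; the level set
    -- `{z > 0}` links the two.
    support : (Fin n → ℕ) → Subset n
    support z = Vec.tabulate (λ u → 0 <ᵇ z u)

  χ-support : ∀ {n} (z : Fin n → ℕ) u → χ (support z) u ≡ sign (z u)
  χ-support z zero with z zero
  ... | zero  = refl
  ... | suc _ = refl
  χ-support z (suc u) = χ-support (z ∘ suc) u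

  -- Degrees, volumes and boundaries through the adjacency matrix

  module _ {n : ℕ} (G : Graph n) where
    open Graph G

    adjacency : Fin n → Fin n → ℕ
    adjacency u v = indicator (u ~? v)

    adjacency-sym : ∀ u v → adjacency u v ≡ adjacency v u
    adjacency-sym u v with u ~? v
    ... | yes u~v = sym (indicator-true (v ~? u) (~-sym u~v))
    ... | no  u≁v = sym (indicator-false (v ~? u) (u≁v ∘ ~-sym))

    sum-adjacency : ∀ u → sum (adjacency u) ≡ degree G u
    sum-adjacency u = sym (begin
      length (filter (u ~?_) (allFin n))                 ≡⟨ length≡sum (filter (u ~?_) (allFin n)) ⟩
      sumₗ (map (λ _ → 1) (filter (u ~?_) (allFin n))) ≡⟨ sum-map-filter (u ~?_) _ (allFin n) ⟩
      sumₗ (map (λ v → adjacency u v * 1) (allFin n))  ≡⟨ sum-map-allFin (λ v → adjacency u v * 1) ⟩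
      sum (λ v → adjacency u v * 1)                      ≡⟨ sum-cong-≗ (λ v → *-identityʳ (adjacency u v)) ⟩
      sum (adjacency u)                                  ∎)
      where open ≡-Reasoning

    ∈-edges : ∀ {u v} → u ~ v → u Fin.< v → (u , v) List.∈ edges G
    ∈-edges {u} {v} u~v u<v = ∈-filter⁺ (λ (u , v) → (u Fin.<? v) ×-dec (u ~? v))
      (∈-cartesianProduct⁺ (∈-allFin u) (∈-allFin v)) (u<v , u~v)

    ~⇒∈-edges : ∀ {u v} → u ~ v → (u , v) List.∈ edges G ⊎ (v , u) List.∈ edges G
    ~⇒∈-edges {u} {v} u~v with Fin.<-cmp u v
    ... | tri< u<v _ _   = inj₁ (∈-edges u~v u<v)
    ... | tri≈ _ u≡v _   = contradiction u~v (~-irrefl u≡v)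
    ... | tri> _ _ v<u   = inj₂ (∈-edges (~-sym u~v) v<u)

    -- Written in the same form as the predicate inside `∂`, so that `∂ G S` is by definition
    -- `edges G` filtered by `crosses? S`.
    Crosses : Subset n → Fin n × Fin n → Set
    Crosses S (u , v) = (u ∈ S × v ∉ S) ⊎ (u ∉ S × v ∈ S)

    crosses? : ∀ S → Decidable (Crosses S)
    crosses? S (u , v) = ((u ∈? S) ×-dec ¬? (v ∈? S)) ⊎-dec (¬? (u ∈? S) ×-dec (v ∈? S))

    crosses⇒∣χ-χ∣≡1 : ∀ S {u v} → Crosses S (u , v) → ∣ χ S u - χ S v ∣ ≡ 1
    crosses⇒∣χ-χ∣≡1 S {u} {v} (inj₁ (u∈S , v∉S)) =
      cong₂ ∣_-_∣ (indicator-true (u ∈? S) u∈S) (indicator-false (v ∈? S) v∉S)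
    crosses⇒∣χ-χ∣≡1 S {u} {v} (inj₂ (u∉S , v∈S)) =
      cong₂ ∣_-_∣ (indicator-false (u ∈? S) u∉S) (indicator-true (v ∈? S) v∈S)

    -- `edges` lists each edge once, smaller endpoint first, while the double sum meets it as
    -- `(u , v)` and as `(v , u)`. Transposing one of the two copies of the sum of `b` accounts for
    -- both.
    2∣∂∣≤ : ∀ S → 2 * length (∂ G S) ≤ ∑[ u < n ] ∑[ v < n ] (adjacency u v * ∣ χ S u - χ S v ∣)
    2∣∂∣≤ S = begin
      2 * length (∂ G S)
        ≡⟨ cong (2 *_) ∣∂∣≡ ⟩
      2 * ∑[ u < n ] ∑[ v < n ] b u v
        ≡⟨ cong (sum (λ u → sum (b u)) +_) (+-identityʳ _) ⟩
      ∑[ u < n ] ∑[ v < n ] b u v + ∑[ u < n ] ∑[ v < n ] b u v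
        ≡⟨ cong (sum (λ u → sum (b u)) +_) (∑-comm b) ⟩
      ∑[ u < n ] ∑[ v < n ] b u v + ∑[ u < n ] ∑[ v < n ] b v u
        ≡⟨ ∑∑-distrib-+ b (λ u v → b v u) ⟨
      ∑[ u < n ] ∑[ v < n ] (b u v + b v u)
        ≤⟨ sum-mono-≤ (λ u → sum-mono-≤ (pair u)) ⟩
      ∑[ u < n ] ∑[ v < n ] (adjacency u v * ∣ χ S u - χ S v ∣) ∎
      where
      open ≤-Reasoning
      edge? : Decidable (λ ((u , v) : Fin n × Fin n) → u Fin.< v × u ~ v)
      edge? (u , v) = (u Fin.<? v) ×-dec (u ~? v)
      b : Fin n → Fin n → ℕ
      b u v = indicator (edge? (u , v)) * indicator (crosses? S (u , v))
      ∣∂∣≡ : length (∂ G S) ≡ ∑[ u < n ] ∑[ v < n ] b u v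
      ∣∂∣≡ = trans (length-filter-filter edge? (crosses? S) (cartesianProduct (allFin n) (allFin n)))
        (trans (sum-map-cartesianProduct (λ (u , v) → b u v) (allFin n) (allFin n))
          (trans (sum-map-allFin (λ u → sumₗ (map (b u) (allFin n)))) (sum-cong-≗ (λ u → sum-map-allFin (b u)))))
      f : Fin n → Fin n → ℕ
      f u v = adjacency u v * ∣ χ S u - χ S v ∣
      f-sym : ∀ u v → f u v ≡ f v u
      f-sym u v = cong₂ _*_ (adjacency-sym u v) (∣-∣-comm (χ S u) (χ S v))
      b≤f : ∀ u v → b u v ≤ f u v
      b≤f u v = indicator-*-≤ (edge? (u , v)) (crosses? S (u , v)) λ (_ , u~v) c →
        cong₂ _*_ (indicator-true (u ~? v) u~v) (crosses⇒∣χ-χ∣≡1 S c)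
      b≡0 : ∀ u v → ¬ u Fin.< v → b u v ≡ 0
      b≡0 u v u≮v = cong (_* indicator (crosses? S (u , v))) (indicator-false (edge? (u , v)) (u≮v ∘ proj₁))
      -- At most one of `b u v` and `b v u` is nonzero, since `b` requires its arguments to be
      -- increasing.
      pair : ∀ u v → b u v + b v u ≤ f u v
      pair u v with u Fin.<? v
      ... | yes u<v = begin
        b u v + b v u   ≡⟨ cong (b u v +_) (b≡0 v u (Fin.<-asym u<v)) ⟩
        b u v + 0       ≡⟨ +-identityʳ _ ⟩
        b u v           ≤⟨ b≤f u v ⟩
        f u v           ∎
      ... | no u≮v = begin
        b u v + b v u   ≡⟨ cong (_+ b v u) (b≡0 u v u≮v) ⟩
        b v u           ≤⟨ b≤f v u ⟩
        f v u           ≡⟨ f-sym v u ⟩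
        f u v           ∎

    path-crosses : ∀ S {u v} → Star _~_ u v → u ∈ S → v ∉ S → ∃[ x ] ∃[ y ] (x ~ y × x ∈ S × y ∉ S)
    path-crosses S ε u∈S v∉S = contradiction u∈S v∉S
    path-crosses S (_◅_ {j = w} u~w path) u∈S v∉S with w ∈? S
    ... | yes w∈S = path-crosses S path w∈S v∉S
    ... | no  w∉S = _ , w , u~w , u∈S , w∉S

    ∣∂∣>0 : ∀ S {x y} → x ~ y → x ∈ S → y ∉ S → 0 < length (∂ G S)
    ∣∂∣>0 S x~y x∈S y∉S with ~⇒∈-edges x~y
    ... | inj₁ e = ∈-length (∈-filter⁺ (crosses? S) e (inj₁ (x∈S , y∉S)))
    ... | inj₂ e = ∈-length (∈-filter⁺ (crosses? S) e (inj₂ (y∉S , x∈S)))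

    module _ {k} (regular : Regular G k) where

      row-sum : ∀ u → sum (adjacency u) ≡ k
      row-sum u = trans (sum-adjacency u) (regular u)

      ~⇒degree>0 : ∀ {u v} → u ~ v → 0 < k
      ~⇒degree>0 {u} {v} u~v = begin
        1                    ≡⟨ indicator-true (u ~? v) u~v ⟨
        adjacency u v        ≤⟨ term≤sum (adjacency u) v ⟩
        sum (adjacency u)    ≡⟨ row-sum u ⟩
        k                    ∎
        where open ≤-Reasoning

      vol≡ : ∀ S → vol G S ≡ k * sum (χ S)
      vol≡ S = begin
        sumₗ (map (degree G) (filter (_∈? S) (allFin n)))
          ≡⟨ sum-map-filter (_∈? S) (degree G) (allFin n) ⟩
        sumₗ (map (λ u → χ S u * degree G u) (allFin n))
          ≡⟨ sum-map-allFin (λ u → χ S u * degree G u) ⟩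
        ∑[ u < n ] (χ S u * degree G u)
          ≡⟨ sum-cong-≗ (λ u → trans (cong (χ S u *_) (regular u)) (*-comm (χ S u) k)) ⟩
        ∑[ u < n ] (k * χ S u)
          ≡⟨ *-distribˡ-sum k (χ S) ⟨
        k * sum (χ S) ∎
        where open ≡-Reasoning

      -- In a regular graph volume is `k` times cardinality, so a set with at most half of the
      -- vertices is also the side of smaller volume.
      small⇒min-vol≡ : ∀ S → 2 * sum (χ S) ≤ n → vol G S ⊓ vol G (∁ S) ≡ k * sum (χ S)
      small⇒min-vol≡ S small = trans (m≤n⇒m⊓n≡m (begin
        vol G S              ≡⟨ vol≡ S ⟩
        k * sum (χ S)        ≤⟨ *-monoʳ-≤ k (+-cancelˡ-≤ (sum (χ S)) _ _ (begin
          sum (χ S) + sum (χ S)       ≡⟨ cong (sum (χ S) +_) (+-identityʳ _) ⟨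
          2 * sum (χ S)               ≤⟨ small ⟩
          n                           ≡⟨ sum-χ-∁ S ⟨
          sum (χ S) + sum (χ (∁ S))   ∎)) ⟩
        k * sum (χ (∁ S))    ≡⟨ vol≡ (∁ S) ⟨
        vol G (∁ S)          ∎)) (vol≡ S)
        where open ≤-Reasoning

  -- The Cheeger constant as an integer isoperimetric inequality

  /₀-pos : ∀ {p q} → 0 < p → 0 < q → 0ℚ ℚ.< p /₀ q
  /₀-pos {suc p} {suc q} _ _ = ℚ.positive⁻¹ (ℤ.+ suc p ℚ./ suc q) {{ℚ.normalize-pos (suc p) (suc q)}}

  -- Cross-multiplication. Positivity of `h` lets the absolute value stand for its numerator, and
  -- `0 < q` keeps clear of the conventional value of `/₀`.
  ≤/₀⇒*≤* : ∀ {h p q} → 0ℚ ℚ.< h → 0 < q → h ℚ.≤ p /₀ q → ℤ.∣ ↥ h ∣ * q ≤ ↧ₙ h * p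
  ≤/₀⇒*≤* {mkℚ (ℤ.+ a) b-1 _} {p} {suc q} _ _ h≤p/q =
    subst (a * suc q ≤_) (*-comm p (suc b-1)) (ℤ.drop‿+≤+ (subst₂ ℤ._≤_ (sym (ℤ.pos-* a (suc q))) (sym (ℤ.pos-* p (suc b-1)))
      (ℚᵘ.drop-*≤* (ℚᵘ.≤-respʳ-≃ (√Lemmas./-≃ p q) (ℚ.toℚᵘ-mono-≤ h≤p/q)))))
  ≤/₀⇒*≤* {mkℚ ℤ.-[1+ _ ] _ _} (ℚ.*<* ())

  module _ {n k : ℕ} (G : Graph n) (connected : Connected G) (regular : Regular G k)
           {h : ℚ} (h-cheeger : IsCheegerConstant G h) where
    open Graph G

    -- The source of both positivity facts: the minimising set exists by definition, and
    -- connectivity gives it a boundary edge. Its endpoints have positive degree, so `k > 0`, and it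
    -- makes the numerator of `h` positive.
    boundary-edge : ∃[ S ] (cheegerRatio G S ≡ h × Nonempty S × S ⊂ ⊤ × ∃[ x ] ∃[ y ] (x ~ y × x ∈ S × y ∉ S))
    boundary-edge with (S , (nonempty@(u , u∈S) , proper@(_ , v , _ , v∉S)) , attained) ← proj₁ h-cheeger =
      S , attained , nonempty , proper , path-crosses G S (connected u v) u∈S v∉S

    degree>0 : 0 < k
    degree>0 with _ , _ , _ , _ , _ , _ , x~y , _ ← boundary-edge = ~⇒degree>0 G regular x~y

    cheeger>0 : 0ℚ ℚ.< h
    cheeger>0 with S , refl , nonempty , (_ , v , _ , v∉S) , _ , _ , x~y , x∈S , y∉S ← boundary-edge =
      /₀-pos (∣∂∣>0 G S x~y x∈S y∉S) (⊓-pres-m< (vol>0 S nonempty) (vol>0 (∁ S) (v , x∉p⇒x∈∁p v∉S)))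
      where
      vol>0 : ∀ S → Nonempty S → 0 < vol G S
      vol>0 S nonempty = subst (0 <_) (sym (vol≡ G regular S))
        (*-mono-< degree>0 (nonempty⇒sum-χ>0 S nonempty))

    isoperimetry : ∀ S → 2 * sum (χ S) ≤ n →
      2 * (ℤ.∣ ↥ h ∣ * (k * sum (χ S))) ≤ ↧ₙ h * ∑[ u < n ] ∑[ v < n ] (adjacency G u v * ∣ χ S u - χ S v ∣)
    -- The empty set is not among the sets defining the Cheeger constant, but it does occur as the
    -- support of a function.
    isoperimetry S small with Fin.any? (_∈? S)
    ... | no empty = begin
        2 * (A * (k * sum (χ S)))
          ≡⟨ cong (λ s → 2 * (A * (k * s))) (trans (sum-cong-≗ (λ u → indicator-false (u ∈? S) (λ u∈S → empty (u , u∈S)))) (sum-replicate-zero n)) ⟩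
        2 * (A * (k * 0))
          ≡⟨ solve 2 (λ A k → con 2 :* (A :* (k :* con 0)) := con 0) refl A k ⟩
        0 ≤⟨ z≤n ⟩
        _ ∎
      where
      open ≤-Reasoning
      open +-*-Solver
      A = ℤ.∣ ↥ h ∣
    ... | yes nonempty = begin
        2 * (A * (k * sum (χ S)))
          ≤⟨ *-monoʳ-≤ 2 (≤/₀⇒*≤* cheeger>0 (*-mono-< degree>0 S>0)
               (subst (λ q → h ℚ.≤ length (∂ G S) /₀ q) (small⇒min-vol≡ G regular S small)
                 (proj₂ h-cheeger S (nonempty , proper)))) ⟩
        2 * (↧ₙ h * length (∂ G S))
          ≡⟨ solve 2 (λ B d → con 2 :* (B :* d) := B :* (con 2 :* d)) refl (↧ₙ h) (length (∂ G S)) ⟩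
        ↧ₙ h * (2 * length (∂ G S))
          ≤⟨ *-monoʳ-≤ (↧ₙ h) (2∣∂∣≤ G S) ⟩
        _ ∎
      where
      open ≤-Reasoning
      open +-*-Solver
      A = ℤ.∣ ↥ h ∣
      S>0 = nonempty⇒sum-χ>0 S nonempty
      proper : S ⊂ ⊤
      proper with Fin.any? (λ u → ¬? (u ∈? S))
      ... | yes (u , u∉S) = (λ _ → ∈⊤) , u , ∈⊤ , u∉S
      -- If `S` contained every vertex, `small` would read `2 * n ≤ n`, although `S` is nonempty.
      ... | no  full = contradiction small (<⇒≱ (begin-strict
        n                  ≡⟨ trans (sum-const n 1) (*-identityʳ n) ⟨
        ∑[ u < n ] 1       ≡⟨ sum-cong-≗ (λ u → indicator-true (u ∈? S) (decidable-stable (u ∈? S) (λ u∉S → full (u , u∉S)))) ⟨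
        sum (χ S)          <⟨ m<m+n (sum (χ S)) S>0 ⟩
        sum (χ S) + sum (χ S) ≡⟨ cong (sum (χ S) +_) (+-identityʳ _) ⟨
        2 * sum (χ S)      ∎))

    graph-integer-bound : ∀ (p : Fin n → ℕ) g → (∀ {u v} → u ~ v → ∣ p u - p v ∣ ≤ g) → ∀ w →
      let A = ℤ.∣ ↥ h ∣; B = ↧ₙ h; e = ∣ n * p w - sum p ∣ in
      2 * (A * A * (e * e)) ≤ n * n * (n ∸ 1) * (B * B * (g * g))
    graph-integer-bound p g steps≤ = integer-bound support-isoperimetry {{>-nonZero degree>0}} p g weighted-steps≤
      where
      open Isoperimetry {A = ℤ.∣ ↥ h ∣} {B = ↧ₙ h} (adjacency G) (adjacency-sym G) (row-sum G regular)
      weighted-steps≤ : ∀ u v → adjacency G u v * ∣ p u - p v ∣ ≤ adjacency G u v * g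
      weighted-steps≤ u v with u ~? v
      ... | yes u~v = *-monoʳ-≤ 1 (steps≤ u~v)
      ... | no _    = z≤n
      support-isoperimetry : ∀ z → 2 * ∑[ u < n ] sign (z u) ≤ n →
        2 * (ℤ.∣ ↥ h ∣ * (k * ∑[ u < n ] sign (z u))) ≤ ↧ₙ h * variation (sign ∘ z)
      support-isoperimetry z small = subst₂ (λ s t → 2 * (ℤ.∣ ↥ h ∣ * (k * s)) ≤ ↧ₙ h * t)
        (sum-cong-≗ (χ-support z))
        (sum-cong-≗ λ u → sum-cong-≗ λ v → cong₂ (λ s t → adjacency G u v * ∣ s - t ∣) (χ-support z u) (χ-support z v))
        (isoperimetry (support z) (≤-trans (≤-reflexive (cong (2 *_) (sum-cong-≗ (χ-support z)))) small))

-- Transfer of the integer inequality to rational vectors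

module Rational where
  open Discrete using (~⇒∈-edges; cheeger>0; graph-integer-bound)
  open import Algebra.Bundles using (CommutativeRing)
  open import Data.Integer using (+_)
  open import Data.List.Membership.Propositional using (_∈_)
  open import Data.List.Relation.Unary.Any using (here; there)
  open import Data.Nat using (ℕ; zero; suc)
  import Data.Nat as ℕ
  import Data.Nat.Properties as ℕ
  open import Data.Rational using (ℚ; 0ℚ; 1ℚ; mkℚ; ↥_; ↧ₙ_; _/_; _+_; _*_; _-_; -_; _≤_; _<_; ∣_∣; _⊔_; _⊓_; positive; nonNegative)
  import Data.Rational as ℚ
  import Data.Rational.Properties as ℚ
  open import Data.Rational.Solver using (module +-*-Solver)
  import Data.Rational.Unnormalised as ℚᵘ
  import Data.Rational.Unnormalised.Properties as ℚᵘ
  open import Relation.Nullary.Decidable using (toWitness)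
  import Algebra.Properties.Semiring.Sum ℕ.+-*-semiring as ℕΣ
  import Algebra.Properties.Semiring.Sum (CommutativeRing.semiring ℚ.+-*-commutativeRing) as ℚΣ

  -- Abstract, as otherwise unification unfolds the gcd normalisation in _/_.
  abstract
    ι : ℕ → ℚ
    ι n = + n / 1

    ι-+ : ∀ a b → ι (a ℕ.+ b) ≡ ι a + ι b
    ι-+ a b = ℚ.toℚᵘ-injective (begin
      ℚ.toℚᵘ (ι (a ℕ.+ b))                           ≈⟨ /-≃ (a ℕ.+ b) 0 ⟩
      ℚᵘ.mkℚᵘ (+ (a ℕ.+ b)) 0                        ≈⟨ ℚᵘ.*≡* (cong (ℤ._* + 1) (sym (cong₂ ℤ._+_ (ℤ.*-identityʳ (+ a)) (ℤ.*-identityʳ (+ b))))) ⟩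
      ℚᵘ.mkℚᵘ (+ a) 0 ℚᵘ.+ ℚᵘ.mkℚᵘ (+ b) 0           ≈⟨ ℚᵘ.+-cong (/-≃ a 0) (/-≃ b 0) ⟨
      ℚ.toℚᵘ (ι a) ℚᵘ.+ ℚ.toℚᵘ (ι b)                 ≈⟨ ℚ.toℚᵘ-homo-+ (ι a) (ι b) ⟨
      ℚ.toℚᵘ (ι a + ι b)                             ∎)
      where open ℚᵘ.≃-Reasoning

    ι-* : ∀ a b → ι (a ℕ.* b) ≡ ι a * ι b
    ι-* a b = ℚ.toℚᵘ-injective (begin
      ℚ.toℚᵘ (ι (a ℕ.* b))                           ≈⟨ /-≃ (a ℕ.* b) 0 ⟩
      ℚᵘ.mkℚᵘ (+ (a ℕ.* b)) 0                        ≈⟨ ℚᵘ.*≡* (cong (ℤ._* + 1) (ℤ.pos-* a b)) ⟩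
      ℚᵘ.mkℚᵘ (+ a) 0 ℚᵘ.* ℚᵘ.mkℚᵘ (+ b) 0           ≈⟨ ℚᵘ.*-cong (/-≃ a 0) (/-≃ b 0) ⟨
      ℚ.toℚᵘ (ι a) ℚᵘ.* ℚ.toℚᵘ (ι b)                 ≈⟨ ℚ.toℚᵘ-homo-* (ι a) (ι b) ⟨
      ℚ.toℚᵘ (ι a * ι b)                             ∎)
      where open ℚᵘ.≃-Reasoning

    /*ι : ∀ a m → (+ a / suc m) * ι (suc m) ≡ ι a
    /*ι a m = ℚ.toℚᵘ-injective (begin
      ℚ.toℚᵘ ((+ a / suc m) * ι (suc m))                ≈⟨ ℚ.toℚᵘ-homo-* (+ a / suc m) (ι (suc m)) ⟩
      ℚ.toℚᵘ (+ a / suc m) ℚᵘ.* ℚ.toℚᵘ (ι (suc m))      ≈⟨ ℚᵘ.*-cong (/-≃ a m) (/-≃ (suc m) 0) ⟩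
      ℚᵘ.mkℚᵘ (+ a) m ℚᵘ.* ℚᵘ.mkℚᵘ (+ suc m) 0
        ≈⟨ ℚᵘ.*≡* (trans (ℤ.*-identityʳ _) (cong (λ x → + a ℤ.* + x) (sym (ℕ.*-identityʳ (suc m))))) ⟩
      ℚᵘ.mkℚᵘ (+ a) 0                                   ≈⟨ /-≃ a 0 ⟨
      ℚ.toℚᵘ (ι a)                                      ∎)
      where open ℚᵘ.≃-Reasoning

    ι-mono-≤ : ∀ {a b} → a ℕ.≤ b → ι a ≤ ι b
    ι-mono-≤ {a} {b} a≤b = /-mono-≤ a b 0 0 (ℕ.*-monoˡ-≤ 1 a≤b)

    ι-cancel-≤ : ∀ {a b} → ι a ≤ ι b → a ℕ.≤ b
    ι-cancel-≤ {a} {b} ιa≤ιb = ℕ.≮⇒≥ λ b<a →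
      ℚ.<-irrefl refl (ℚ.<-≤-trans (/-mono-< b a 0 0 (ℕ.*-monoˡ-< 1 b<a)) ιa≤ιb)

    0≤ι : ∀ n → 0ℚ ≤ ι n
    0≤ι n = ι-mono-≤ {0} {n} ℕ.z≤n

    ι-pos : ∀ n → .{{ℕ.NonZero n}} → ℚ.Positive (ι n)
    ι-pos (suc n) = ℚ.normalize-pos (suc n) 1

    ι0≡0 : ι 0 ≡ 0ℚ
    ι0≡0 = refl

    ι1≡1 : ι 1 ≡ 1ℚ
    ι1≡1 = refl

  ι-∣-∣-≤ : ∀ {a b} → a ℕ.≤ b → ι ℕ.∣ a - b ∣ ≡ ∣ ι b - ι a ∣
  ι-∣-∣-≤ {a} {b} a≤b with d , refl ← ℕ.m≤n⇒∃[o]m+o≡n a≤b = begin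
    ι ℕ.∣ a - a ℕ.+ d ∣     ≡⟨ cong ι (ℕ.∣m-m+n∣≡n a d) ⟩
    ι d                     ≡⟨ ℚ.0≤p⇒∣p∣≡p (0≤ι d) ⟨
    ∣ ι d ∣                 ≡⟨ cong ∣_∣ (Identities.cancel (ι a) (ι d)) ⟨
    ∣ ι a + ι d - ι a ∣     ≡⟨ cong (λ s → ∣ s - ι a ∣) (ι-+ a d) ⟨
    ∣ ι (a ℕ.+ d) - ι a ∣   ∎
    where open ≡-Reasoning

  ι-∣-∣ : ∀ a b → ι ℕ.∣ a - b ∣ ≡ ∣ ι a - ι b ∣
  ι-∣-∣ a b with ℕ.≤-total a b
  ... | inj₁ a≤b = trans (ι-∣-∣-≤ a≤b) (∣p-q∣-comm (ι b) (ι a))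
  ... | inj₂ b≤a = trans (cong ι (ℕ.∣-∣-comm a b)) (ι-∣-∣-≤ b≤a)

  ι-sum : ∀ {n} (p : Fin n → ℕ) → ι (ℕΣ.sum p) ≡ ℚΣ.sum (ι ∘ p)
  ι-sum {zero}  p = ι0≡0
  ι-sum {suc n} p = trans (ι-+ (p zero) _) (cong (ℚ._+_ (ι (p zero))) (ι-sum (p ∘ suc)))

  sum-const-ℚ : ∀ n c → ℚΣ.sum {n} (λ _ → c) ≡ ι n * c
  sum-const-ℚ zero    c = sym (trans (cong (ℚ._* c) ι0≡0) (ℚ.*-zeroˡ c))
  sum-const-ℚ (suc n) c = begin
    c + ℚΣ.sum {n} (λ _ → c)    ≡⟨ cong₂ _+_ (sym (ℚ.*-identityˡ c)) (sum-const-ℚ n c) ⟩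
    1ℚ * c + ι n * c            ≡⟨ ℚ.*-distribʳ-+ c 1ℚ (ι n) ⟨
    (1ℚ + ι n) * c              ≡⟨ cong (ℚ._* c) (trans (ι-+ 1 n) (cong (ℚ._+ ι n) ι1≡1)) ⟨
    ι (suc n) * c               ∎
    where open ≡-Reasoning

  sq-mono-≤ : ∀ {p q} → 0ℚ ≤ p → p ≤ q → p * p ≤ q * q
  sq-mono-≤ {p} {q} 0≤p p≤q = ℚ.≤-trans
    (ℚ.*-monoˡ-≤-nonNeg p {{nonNegative 0≤p}} p≤q)
    (ℚ.*-monoʳ-≤-nonNeg q {{nonNegative (ℚ.≤-trans 0≤p p≤q)}} p≤q)

  sq-cancel-≤ : ∀ {p q} → 0ℚ ≤ q → p * p ≤ q * q → p ≤ q
  sq-cancel-≤ {p} {q} 0≤q p²≤q² = ℚ.≮⇒≥ λ q<p → ℚ.<-irrefl refl (ℚ.<-≤-trans (ℚ.≤-<-trans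
    (ℚ.*-monoˡ-≤-nonNeg q {{nonNegative 0≤q}} (ℚ.<⇒≤ q<p))
    (ℚ.*-monoˡ-<-pos p {{positive (ℚ.≤-<-trans 0≤q q<p)}} q<p)) p²≤q²)

  ∣p∣*∣p∣≡p*p : ∀ p → ∣ p ∣ * ∣ p ∣ ≡ p * p
  ∣p∣*∣p∣≡p*p p with ℚ.∣p∣≡p∨∣p∣≡-p p
  ... | inj₁ eq rewrite eq = refl
  ... | inj₂ eq rewrite eq = solve 1 (λ p → (:- p) :* (:- p) := p :* p) refl p
    where open +-*-Solver

  ι↧*≡ι↥ : ∀ r → 0ℚ ≤ r → ι (↧ₙ r) * r ≡ ι ℤ.∣ ↥ r ∣
  ι↧*≡ι↥ r@(mkℚ (+ a) b _) _ = trans (ℚ.*-comm (ι (suc b)) r)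
    (trans (cong (ℚ._* ι (suc b)) (sym (ℚ.↥p/↧p≡p r))) (/*ι a b))
  ι↧*≡ι↥ (mkℚ ℤ.-[1+ _ ] _ _) (ℚ.*≤* ())

  common-denominator : ∀ {m} (q : Fin m → ℚ) → (∀ i → 0ℚ ≤ q i) →
    ∃[ N ] (ℕ.NonZero N × Σ[ p ∈ (Fin m → ℕ) ] (∀ i → ι (p i) ≡ ι N * q i))
  common-denominator {zero}  q 0≤q = 1 , _ , (λ ()) , λ ()
  common-denominator {suc m} q 0≤q with N , N≢0 , p , p≡ ← common-denominator (q ∘ suc) (0≤q ∘ suc) =
    b ℕ.* N , ℕ.m*n≢0 b N {{_}} {{N≢0}} ,
    (λ { zero → N ℕ.* ℤ.∣ ↥ r ∣ ; (suc i) → b ℕ.* p i }) ,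
    λ { zero → begin
          ι (N ℕ.* ℤ.∣ ↥ r ∣)          ≡⟨ ι-* N ℤ.∣ ↥ r ∣ ⟩
          ι N * ι ℤ.∣ ↥ r ∣            ≡⟨ cong (ℚ._*_ (ι N)) (ι↧*≡ι↥ r (0≤q zero)) ⟨
          ι N * (ι b * r)
            ≡⟨ solve 3 (λ N r b → N :* (b :* r) := b :* N :* r) refl (ι N) r (ι b) ⟩
          ι b * ι N * r                ≡⟨ cong (ℚ._* r) (ι-* b N) ⟨
          ι (b ℕ.* N) * r              ∎
      ; (suc i) → begin
          ι (b ℕ.* p i)                ≡⟨ ι-* b (p i) ⟩
          ι b * ι (p i)                ≡⟨ cong (ℚ._*_ (ι b)) (p≡ i) ⟩
          ι b * (ι N * q (suc i))      ≡⟨ ℚ.*-assoc (ι b) (ι N) (q (suc i)) ⟨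
          ι b * ι N * q (suc i)        ≡⟨ cong (ℚ._* q (suc i)) (ι-* b N) ⟨
          ι (b ℕ.* N) * q (suc i)      ∎ }
    where
    open +-*-Solver
    open ≡-Reasoning
    r = q zero
    b = ↧ₙ r

  -- Entries of a vector with mean near 0 may be negative; a shift by `c` makes them eligible for
  -- clearing denominators into `ℕ`.
  lower-bound : ∀ {n} (q : Fin n → ℚ) → ∃[ c ] (∀ v → 0ℚ ≤ q v + c)
  lower-bound {zero}  q = 0ℚ , λ ()
  lower-bound {suc n} q with c , 0≤q+c ← lower-bound (q ∘ suc) = c ⊔ - q zero , λ
    { zero    → ℚ.≤-trans (ℚ.≤-reflexive (sym (ℚ.+-inverseʳ (q zero)))) (ℚ.+-monoʳ-≤ (q zero) (ℚ.p≤q⊔p c (- q zero)))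
    ; (suc v) → ℚ.≤-trans (0≤q+c v) (ℚ.+-monoʳ-≤ (q (suc v)) (ℚ.p≤p⊔q c (- q zero))) }

  module _ {n k : ℕ} (G : Graph n) (connected : Connected G) (regular : Regular G k)
           {h : ℚ} (h-cheeger : IsCheegerConstant G h) where
    open Graph G

    nonneg-rational-bound : ∀ (q : Fin n → ℚ) → (∀ v → 0ℚ ≤ q v) → ∀ g → 0ℚ ≤ g →
      (∀ {u v} → u ~ v → ∣ q u - q v ∣ ≤ g) → ∀ w →
      let D = ι n * q w - ℚΣ.sum q in
      ι 2 * (h * h * (D * D)) ≤ ι (n ℕ.* n ℕ.* (n ℕ.∸ 1)) * (g * g)
    nonneg-rational-bound q 0≤q g 0≤g steps≤ w
      -- `g` is put at the head of the family, so that one `N` scales both the vector and the step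
      -- bound.
      with N , N≢0 , p , p≡ ← common-denominator (λ { zero → g ; (suc v) → q v }) (λ { zero → 0≤g ; (suc v) → 0≤q v })
      -- `ι B` clears the denominator of `h` and `ι N` those of `q` and `g`; each side has degree
      -- two in both.
      = ℚ.*-cancelˡ-≤-pos (BN * BN) {{ℚ.pos*pos⇒pos BN {{BN>0}} BN {{BN>0}}}} (begin
        BN * BN * (ι 2 * (h * h * (D * D)))
          ≡⟨ solve 5 (λ B N t h D → B :* N :* (B :* N) :* (t :* (h :* h :* (D :* D))) :=
               t :* (B :* h :* (B :* h) :* (N :* D :* (N :* D)))) refl (ι B) (ι N) (ι 2) h D ⟩
        ι 2 * (ι B * h * (ι B * h) * (ι N * D * (ι N * D)))
          ≡⟨ cong₂ (λ a d → ι 2 * (a * a * d)) (ι↧*≡ι↥ h (ℚ.<⇒≤ (cheeger>0 G connected regular h-cheeger))) (trans (sym (∣p∣*∣p∣≡p*p (ι N * D))) (cong (λ s → s * s) (sym ιe≡))) ⟩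
        ι 2 * (ι A * ι A * (ι e * ι e))
          ≡⟨ cong (ℚ._*_ (ι 2)) (cong₂ _*_ (ι-* A A) (ι-* e e)) ⟨
        ι 2 * (ι (A ℕ.* A) * ι (e ℕ.* e))
          ≡⟨ trans (ι-* 2 (A ℕ.* A ℕ.* (e ℕ.* e))) (cong (ℚ._*_ (ι 2)) (ι-* (A ℕ.* A) (e ℕ.* e))) ⟨
        ι (2 ℕ.* (A ℕ.* A ℕ.* (e ℕ.* e)))
          ≤⟨ ι-mono-≤ (graph-integer-bound G connected regular h-cheeger p′ g′ integer-steps≤ w) ⟩
        ι (c ℕ.* (B ℕ.* B ℕ.* (g′ ℕ.* g′)))
          ≡⟨ trans (ι-* c (B ℕ.* B ℕ.* (g′ ℕ.* g′))) (cong (ℚ._*_ (ι c)) (ι-* (B ℕ.* B) (g′ ℕ.* g′))) ⟩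
        ι c * (ι (B ℕ.* B) * ι (g′ ℕ.* g′))
          ≡⟨ cong (ℚ._*_ (ι c)) (cong₂ _*_ (ι-* B B) (ι-* g′ g′)) ⟩
        ι c * (ι B * ι B * (ι g′ * ι g′))
          ≡⟨ cong (λ s → ι c * (ι B * ι B * (s * s))) (p≡ zero) ⟩
        ι c * (ι B * ι B * (ι N * g * (ι N * g)))
          ≡⟨ solve 4 (λ c B N g → c :* (B :* B :* (N :* g :* (N :* g))) := B :* N :* (B :* N) :* (c :* (g :* g)))
               refl (ι c) (ι B) (ι N) g ⟩
        BN * BN * (ι c * (g * g)) ∎)
      where
      open ℚ.≤-Reasoning
      open +-*-Solver
      A = ℤ.∣ ↥ h ∣
      B = ↧ₙ h
      c = n ℕ.* n ℕ.* (n ℕ.∸ 1)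
      D = ι n * q w - ℚΣ.sum q
      BN = ι B * ι N
      BN>0 : ℚ.Positive BN
      BN>0 = ℚ.pos*pos⇒pos (ι B) {{ι-pos B}} (ι N) {{ι-pos N {{N≢0}}}}
      g′ = p zero
      p′ : Fin n → ℕ
      p′ v = p (suc v)
      e = ℕ.∣ n ℕ.* p′ w - ℕΣ.sum p′ ∣
      ∣N*∣ : ∀ r → ∣ ι N * r ∣ ≡ ι N * ∣ r ∣
      ∣N*∣ r = trans (ℚ.∣p*q∣≡∣p∣*∣q∣ (ι N) r) (cong (ℚ._* ∣ r ∣) (ℚ.0≤p⇒∣p∣≡p (0≤ι N)))
      integer-steps≤ : ∀ {u v} → u ~ v → ℕ.∣ p′ u - p′ v ∣ ℕ.≤ g′
      integer-steps≤ {u} {v} u~v = ι-cancel-≤ (begin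
        ι ℕ.∣ p′ u - p′ v ∣         ≡⟨ ι-∣-∣ (p′ u) (p′ v) ⟩
        ∣ ι (p′ u) - ι (p′ v) ∣     ≡⟨ cong₂ (λ s t → ∣ s - t ∣) (p≡ (suc u)) (p≡ (suc v)) ⟩
        ∣ ι N * q u - ι N * q v ∣
          ≡⟨ cong ∣_∣ (solve 3 (λ N a b → N :* a :- N :* b := N :* (a :- b)) refl (ι N) (q u) (q v)) ⟩
        ∣ ι N * (q u - q v) ∣       ≡⟨ ∣N*∣ _ ⟩
        ι N * ∣ q u - q v ∣         ≤⟨ ℚ.*-monoˡ-≤-nonNeg (ι N) {{nonNegative (0≤ι N)}} (steps≤ u~v) ⟩
        ι N * g                     ≡⟨ p≡ zero ⟨
        ι g′                        ∎)
      ιe≡ : ι e ≡ ∣ ι N * D ∣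
      ιe≡ = begin-equality
        ι e
          ≡⟨ ι-∣-∣ (n ℕ.* p′ w) (ℕΣ.sum p′) ⟩
        ∣ ι (n ℕ.* p′ w) - ι (ℕΣ.sum p′) ∣
          ≡⟨ cong₂ (λ s t → ∣ s - t ∣) (trans (ι-* n (p′ w)) (cong (ℚ._*_ (ι n)) (p≡ (suc w))))
               (trans (ι-sum p′) (trans (ℚΣ.sum-cong-≗ (λ v → p≡ (suc v))) (sym (ℚΣ.*-distribˡ-sum (ι N) q)))) ⟩
        ∣ ι n * (ι N * q w) - ι N * ℚΣ.sum q ∣
          ≡⟨ cong ∣_∣ (solve 4 (λ n N a s → n :* (N :* a) :- N :* s := N :* (n :* a :- s)) refl (ι n) (ι N) (q w) (ℚΣ.sum q)) ⟩
        ∣ ι N * D ∣ ∎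

    -- Shifting all entries by `c` adds `ι n * c` to both terms of `D` and leaves edge differences
    -- alone, so nonnegativity can be arranged beforehand.
    rational-bound : ∀ (q : Fin n → ℚ) g → 0ℚ ≤ g →
      (∀ {u v} → u ~ v → ∣ q u - q v ∣ ≤ g) → ∀ w →
      let D = ι n * q w - ℚΣ.sum q in
      ι 2 * (h * h * (D * D)) ≤ ι (n ℕ.* n ℕ.* (n ℕ.∸ 1)) * (g * g)
    rational-bound q g 0≤g steps≤ w with c , 0≤q+c ← lower-bound q =
      subst (λ D → ι 2 * (h * h * (D * D)) ≤ ι (n ℕ.* n ℕ.* (n ℕ.∸ 1)) * (g * g)) D-shift
        (nonneg-rational-bound (λ v → q v + c) 0≤q+c g 0≤g
          (λ {u} {v} u~v → subst (λ d → ∣ d ∣ ≤ g) (sym (difference-shift (q u) (q v))) (steps≤ u~v)) w)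
      where
      open +-*-Solver
      difference-shift : ∀ a b → a + c - (b + c) ≡ a - b
      difference-shift a b = solve 3 (λ a b c → a :+ c :- (b :+ c) := a :- b) refl a b c
      D-shift : ι n * (q w + c) - ℚΣ.sum (λ v → q v + c) ≡ ι n * q w - ℚΣ.sum q
      D-shift = begin
        ι n * (q w + c) - ℚΣ.sum (λ v → q v + c)
          ≡⟨ cong (ℚ._-_ (ι n * (q w + c))) (trans (ℚΣ.∑-distrib-+ q (λ _ → c)) (cong (ℚ._+_ (ℚΣ.sum q)) (sum-const-ℚ n c))) ⟩
        ι n * (q w + c) - (ℚΣ.sum q + ι n * c)
          ≡⟨ solve 4 (λ n a c s → n :* (a :+ c) :- (s :+ n :* c) := n :* a :- s) refl (ι n) (q w) c (ℚΣ.sum q) ⟩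
        ι n * q w - ℚΣ.sum q ∎
        where open ≡-Reasoning

  -- Real sequences at a single index

  Eventually : (ℕ → Set) → Set
  Eventually P = ∃[ N ] (∀ m → N ℕ.≤ m → P m)

  eventually-× : ∀ {P Q} → Eventually P → Eventually Q → Eventually (λ m → P m × Q m)
  eventually-× (M , P) (N , Q) = M ℕ.+ N , λ m M+N≤m →
    P m (ℕ.m+n≤o⇒m≤o M M+N≤m) , Q m (ℕ.m+n≤o⇒n≤o M M+N≤m)

  eventually-map : ∀ {P Q : ℕ → Set} → (∀ m → P m → Q m) → Eventually P → Eventually Q
  eventually-map f (N , P) = N , λ m N≤m → f m (P m N≤m)

  eventually-1/m≤ : ∀ {δ} → 0ℚ < δ → Eventually (λ m → + 1 / suc m ≤ δ)
  eventually-1/m≤ {δ} δ>0 = below (archimedean δ δ>0)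
    where
    below : ∃[ N ] (+ 1 / suc N) < δ → Eventually (λ m → + 1 / suc m ≤ δ)
    below (N , 1/N<δ) = N , λ m N≤m →
      ℚ.≤-trans (/-mono-≤ 1 1 m N (ℕ.*-monoʳ-≤ 1 (ℕ.s≤s N≤m))) (ℚ.<⇒≤ 1/N<δ)

  module _ (m : ℕ) where

    0≤max : ∀ l → 0ℚ ≤ seq (max l) m
    0≤max []      = ℚ.≤-refl
    0≤max (y ∷ l) = ℚ.≤-trans (0≤max l) (ℚ.p≤q⊔p (seq y m) (seq (max l) m))

    ∈⇒≤max : ∀ {y l} → y ∈ l → seq y m ≤ seq (max l) m
    ∈⇒≤max {l = y ∷ l} (here refl) = ℚ.p≤p⊔q (seq y m) (seq (max l) m)
    ∈⇒≤max {l = z ∷ l} (there y∈l) = ℚ.≤-trans (∈⇒≤max y∈l) (ℚ.p≤q⊔p (seq z m) (seq (max l) m))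

    -- `max` starts from 0, so its value could be that default; strict positivity forces it to come
    -- from an actual entry, which may differ from one index `m` to the next.
    max-attained : ∀ l → 0ℚ < seq (max l) m → ∃[ y ] (y ∈ l × seq (max l) m ≡ seq y m)
    max-attained []      0<0 = contradiction 0<0 (ℚ.<-irrefl refl)
    max-attained (y ∷ l) 0<max = attained (ℚ.⊔-sel (seq y m) (seq (max l) m))
      where
      attained : seq (max (y ∷ l)) m ≡ seq y m ⊎ seq (max (y ∷ l)) m ≡ seq (max l) m →
                 ∃[ z ] (z ∈ y ∷ l × seq (max (y ∷ l)) m ≡ seq z m)
      attained (inj₁ max≡y) = y , here refl , max≡y
      attained (inj₂ max≡l) =
        let z , z∈l , l≡z = max-attained l (subst (0ℚ <_) max≡l 0<max)
        in z , there z∈l , trans max≡l l≡z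

    seq-sum : ∀ {n} (x : Fin n → ℝ) →
      seq (foldr _+ℝ_ 0ℝ (map x (allFin n))) m ≡ ℚΣ.sum (λ v → seq (x v) m)
    seq-sum x = trans (cong (λ l → seq (foldr _+ℝ_ 0ℝ l) m) (map-tabulate id x)) (seq-sum-tabulate x)
      where
      seq-sum-tabulate : ∀ {n} (x : Fin n → ℝ) →
        seq (foldr _+ℝ_ 0ℝ (tabulate x)) m ≡ ℚΣ.sum (λ v → seq (x v) m)
      seq-sum-tabulate {zero}  x = refl
      seq-sum-tabulate {suc n} x = cong (ℚ._+_ (seq (x zero) m)) (seq-sum-tabulate (x ∘ suc))

  ∣p-q∣<ε⇒p<q+ε : ∀ {p q ε} → ∣ p - q ∣ < ε → p < q + ε
  ∣p-q∣<ε⇒p<q+ε {p} {q} close = ℚ.≤-<-trans (p≤q+∣p-q∣ p q) (ℚ.+-monoʳ-< q close)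

  ∣p-q∣<ε⇒q<p+ε : ∀ {p q ε} → ∣ p - q ∣ < ε → q < p + ε
  ∣p-q∣<ε⇒q<p+ε {p} {q} {ε} close = ∣p-q∣<ε⇒p<q+ε (subst (_< ε) (∣p-q∣-comm p q) close)

  0≤√-approx : ∀ N m → 0ℚ ≤ √-approx N m
  0≤√-approx N m = /-mono-≤ 0 ⌊√ N ℕ.* (suc m ℕ.* suc m) ⌋ 0 m ℕ.z≤n

  [p*q]² : ∀ p q → p * q * (p * q) ≡ p * p * (q * q)
  [p*q]² = solve 2 (λ p q → p :* q :* (p :* q) := p :* p :* (q :* q)) refl
    where open +-*-Solver

  -- `√-approx` rounds down to a multiple of `1 / (m + 1)`, so one further grid step reaches past
  -- the root.
  N≤[√-approx+1/m]² : ∀ N m → let s = √-approx N m + (+ 1 / suc m) in ι N ≤ s * s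
  N≤[√-approx+1/m]² N m = ℚ.*-cancelʳ-≤-pos (M * M) {{ℚ.pos*pos⇒pos M {{M>0}} M {{M>0}}}} (begin
    ι N * (M * M)
      ≡⟨ trans (ι-* N (suc m ℕ.* suc m)) (cong (ι N *_) (ι-* (suc m) (suc m))) ⟨
    ι (N ℕ.* (suc m ℕ.* suc m))
      ≤⟨ ι-mono-≤ (ℕ.<⇒≤ (⌊√⌋-upper (N ℕ.* (suc m ℕ.* suc m)))) ⟩
    ι (suc r ℕ.* suc r)
      ≡⟨ ι-* (suc r) (suc r) ⟩
    ι (suc r) * ι (suc r)
      ≡⟨ cong (λ t → t * t) (trans (cong (_* M) (sym (/-suc r m))) (/*ι (suc r) m)) ⟨
    s * M * (s * M)
      ≡⟨ [p*q]² s M ⟩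
    s * s * (M * M) ∎)
    where
    open ℚ.≤-Reasoning
    r = ⌊√ N ℕ.* (suc m ℕ.* suc m) ⌋
    s = √-approx N m + (+ 1 / suc m)
    M = ι (suc m)
    M>0 = ι-pos (suc m)

  -- Error estimates and the strict inequality of reals

  module _ {n k : ℕ} (G : Graph n) (connected : Connected G) (regular : Regular G k)
           {h : ℚ} (h-cheeger : IsCheegerConstant G h) where
    open Graph G

    private
      h>0 : 0ℚ < h
      h>0 = cheeger>0 G connected regular h-cheeger

    -- The factor 2 gained over h² ≤ (n - 1) γ² leaves room for the rounding errors:
    -- 2 (9/10)² ≥ (5/4)².
    approximate-bound : ∀ (q : Fin n → ℚ) w g → 0ℚ ≤ g → (∀ {u v} → u ~ v → ∣ q u - q v ∣ ≤ g) →
      ∣ ℚΣ.sum q ∣ ≤ + 1 / 20 → + 19 / 20 ≤ ∣ q w ∣ →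
      ∀ s → 0ℚ ≤ s → ι (n ℕ.∸ 1) ≤ s * s → (+ 5 / 4) * h ≤ s * g
    approximate-bound q w g 0≤g steps≤ sum-small q-large s 0≤s s²≥n-1 = sq-cancel-≤ 0≤sg (begin
      (+ 5 / 4) * h * ((+ 5 / 4) * h)
        ≡⟨ solve 1 (λ h → con (+ 5 / 4) :* h :* (con (+ 5 / 4) :* h) := con (+ 25 / 16) :* (h :* h)) refl h ⟩
      (+ 25 / 16) * (h * h)
        ≤⟨ ℚ.*-monoʳ-≤-nonNeg (h * h) {{h²≥0}} (toWitness {a? = (+ 25 / 16) ℚ.≤? (+ 81 / 50)} _) ⟩
      (+ 81 / 50) * (h * h)
        ≤⟨ without-n ⟩
      ι (n ℕ.∸ 1) * (g * g)
        ≤⟨ ℚ.*-monoʳ-≤-nonNeg (g * g) {{ℚ.nonNeg*nonNeg⇒nonNeg g {{nonNegative 0≤g}} g {{nonNegative 0≤g}}}} s²≥n-1 ⟩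
      s * s * (g * g)
        ≡⟨ solve 2 (λ s g → s :* s :* (g :* g) := s :* g :* (s :* g)) refl s g ⟩
      s * g * (s * g) ∎)
      where
      open ℚ.≤-Reasoning
      open +-*-Solver
      N = ι n
      D = N * q w - ℚΣ.sum q
      0≤sg : 0ℚ ≤ s * g
      0≤sg = ℚ.nonNegative⁻¹ (s * g) {{ℚ.nonNeg*nonNeg⇒nonNeg s {{nonNegative 0≤s}} g {{nonNegative 0≤g}}}}
      h²≥0 : ℚ.NonNegative (h * h)
      h²≥0 = ℚ.pos⇒nonNeg (h * h) {{ℚ.pos*pos⇒pos h {{positive h>0}} h {{positive h>0}}}}
      n≢0 : ∀ {n} → Fin n → ℕ.NonZero n
      n≢0 zero    = _
      n≢0 (suc _) = _
      N>0 : ℚ.Positive N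
      N>0 = ι-pos n {{n≢0 w}}
      N²>0 : ℚ.Positive (N * N)
      N²>0 = ℚ.pos*pos⇒pos N {{N>0}} N {{N>0}}
      1≤N : 1ℚ ≤ N
      1≤N = subst (_≤ N) ι1≡1 (ι-mono-≤ (ℕ.>-nonZero⁻¹ n {{n≢0 w}}))
      -- The constants `19/20` and `1/20` serve this estimate: `19n/20 - 1/20 ≥ 9n/10` because
      -- `n ≥ 1`.
      D-large : N * (+ 9 / 10) ≤ ∣ D ∣
      D-large = begin
        N * (+ 9 / 10)
          ≡⟨ solve 1 (λ N → N :* con (+ 9 / 10) := N :* con (+ 19 / 20) :- con (+ 1 / 20) :* N) refl N ⟩
        N * (+ 19 / 20) - (+ 1 / 20) * N
          ≤⟨ ℚ.+-mono-≤ (ℚ.*-monoˡ-≤-nonNeg N {{ℚ.pos⇒nonNeg N {{N>0}}}} q-large)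
               (ℚ.neg-antimono-≤ (ℚ.*-monoˡ-≤-nonNeg (+ 1 / 20) 1≤N)) ⟩
        N * ∣ q w ∣ - (+ 1 / 20) * 1ℚ
          ≡⟨ cong (_- (+ 1 / 20)) (trans (ℚ.∣p*q∣≡∣p∣*∣q∣ N (q w)) (cong (_* ∣ q w ∣) (ℚ.0≤p⇒∣p∣≡p (0≤ι n)))) ⟨
        ∣ N * q w ∣ - (+ 1 / 20)
          ≤⟨ ℚ.+-monoʳ-≤ ∣ N * q w ∣ (ℚ.neg-antimono-≤ sum-small) ⟩
        ∣ N * q w ∣ - ∣ ℚΣ.sum q ∣
          ≤⟨ ℚ.+-monoˡ-≤ (- ∣ ℚΣ.sum q ∣) (∣p∣≤∣q∣+∣p-q∣ (N * q w) (ℚΣ.sum q)) ⟩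
        ∣ ℚΣ.sum q ∣ + ∣ D ∣ - ∣ ℚΣ.sum q ∣
          ≡⟨ Identities.cancel ∣ ℚΣ.sum q ∣ ∣ D ∣ ⟩
        ∣ D ∣ ∎
      without-n : (+ 81 / 50) * (h * h) ≤ ι (n ℕ.∸ 1) * (g * g)
      without-n = ℚ.*-cancelˡ-≤-pos (N * N) {{N²>0}} (begin
        N * N * ((+ 81 / 50) * (h * h))
          ≡⟨ solve 2 (λ N h → N :* N :* (con (+ 81 / 50) :* (h :* h)) :=
               (con 1ℚ :+ con 1ℚ) :* (h :* h :* (N :* con (+ 9 / 10) :* (N :* con (+ 9 / 10))))) refl N h ⟩
        (1ℚ + 1ℚ) * (h * h * (N * (+ 9 / 10) * (N * (+ 9 / 10))))
          ≤⟨ ℚ.*-monoˡ-≤-nonNeg (1ℚ + 1ℚ) (ℚ.*-monoˡ-≤-nonNeg (h * h) {{h²≥0}} (sq-mono-≤ 0≤9N/10 D-large)) ⟩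
        (1ℚ + 1ℚ) * (h * h * (∣ D ∣ * ∣ D ∣))
          ≡⟨ cong₂ (λ a b → a * (h * h * b)) (sym (trans (ι-+ 1 1) (cong₂ _+_ ι1≡1 ι1≡1))) (∣p∣*∣p∣≡p*p D) ⟩
        ι 2 * (h * h * (D * D))
          ≤⟨ rational-bound G connected regular h-cheeger q g 0≤g steps≤ w ⟩
        ι (n ℕ.* n ℕ.* (n ℕ.∸ 1)) * (g * g)
          ≡⟨ cong (_* (g * g)) (trans (ι-* (n ℕ.* n) (n ℕ.∸ 1)) (cong (_* ι (n ℕ.∸ 1)) (ι-* n n))) ⟩
        N * N * ι (n ℕ.∸ 1) * (g * g)
          ≡⟨ ℚ.*-assoc (N * N) (ι (n ℕ.∸ 1)) (g * g) ⟩
        N * N * (ι (n ℕ.∸ 1) * (g * g)) ∎)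
        where
        0≤9N/10 : 0ℚ ≤ N * (+ 9 / 10)
        0≤9N/10 = ℚ.nonNegative⁻¹ (N * (+ 9 / 10)) {{ℚ.nonNeg*nonNeg⇒nonNeg N {{ℚ.pos⇒nonNeg N {{N>0}}}} (+ 9 / 10)}}

    module _ (x : Fin n → ℝ) (m : ℕ) (δ : ℚ) (δ≤1/20 : δ ≤ + 1 / 20) where

      index-bound : ∣ seq (foldr _+ℝ_ 0ℝ (map x (allFin n))) m - 0ℚ ∣ < δ → ∣ seq ‖ x ‖∞ m - 1ℚ ∣ < δ →
        + 1 / suc m ≤ δ →
        (+ 5 / 4) * h ≤ (√-approx (n ℕ.∸ 1) m + δ) * seq (γ⟨_⟩ G x) m
      index-bound sum≈0 norm≈1 1/m≤δ =
        approximate-bound q (proj₁ large-entry) (seq (γ⟨_⟩ G x) m)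
          (0≤max m (map (λ (u , v) → ∣ x u -ℝ x v ∣ℝ) (edges G))) steps≤ sum-small
          (proj₂ large-entry) (s + δ)
          -- The root is replaced by `s + δ` because `s` itself may fall short of it by up to
          -- `1 / (m + 1)`, which is at most `δ`.
          (ℚ.+-mono-≤ (0≤√-approx (n ℕ.∸ 1) m) (ℚ.<⇒≤ 0<δ))
          (ℚ.≤-trans (N≤[√-approx+1/m]² (n ℕ.∸ 1) m)
            (sq-mono-≤ (ℚ.+-mono-≤ (0≤√-approx (n ℕ.∸ 1) m) (ℚ.nonNegative⁻¹ (+ 1 / suc m) {{ℚ.normalize-nonNeg 1 (suc m)}}))
                       (ℚ.+-monoʳ-≤ s 1/m≤δ)))
        where
        open ℚ.≤-Reasoning
        q : Fin n → ℚ
        q v = seq (x v) m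
        s = √-approx (n ℕ.∸ 1) m
        norm-large : + 19 / 20 ≤ seq ‖ x ‖∞ m
        norm-large = begin
          1ℚ - (+ 1 / 20)                                 ≤⟨ ℚ.+-monoʳ-≤ 1ℚ (ℚ.neg-antimono-≤ δ≤1/20) ⟩
          1ℚ - δ                                          ≤⟨ ℚ.+-monoˡ-≤ (- δ) (ℚ.<⇒≤ (∣p-q∣<ε⇒q<p+ε {seq ‖ x ‖∞ m} {1ℚ} norm≈1)) ⟩
          seq ‖ x ‖∞ m + δ - δ                            ≡⟨ trans (ℚ.+-assoc (seq ‖ x ‖∞ m) δ (- δ)) (trans (cong (ℚ._+_ (seq ‖ x ‖∞ m)) (ℚ.+-inverseʳ δ)) (ℚ.+-identityʳ _)) ⟩
          seq ‖ x ‖∞ m                                    ∎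
        sum-small : ∣ ℚΣ.sum q ∣ ≤ + 1 / 20
        sum-small = begin
          ∣ ℚΣ.sum q ∣                                            ≡⟨ cong ∣_∣ (trans (ℚ.+-identityʳ _) (seq-sum m x)) ⟨
          ∣ seq (foldr _+ℝ_ 0ℝ (map x (allFin n))) m - 0ℚ ∣       <⟨ sum≈0 ⟩
          δ                                                       ≤⟨ δ≤1/20 ⟩
          + 1 / 20                                                ∎
        0<δ : 0ℚ < δ
        0<δ = ℚ.<-≤-trans (ℚ.positive⁻¹ (+ 1 / suc m) {{ℚ.normalize-pos 1 (suc m)}}) 1/m≤δ
        edge≤ : ∀ {u v} → (u , v) ∈ edges G → ∣ q u - q v ∣ ≤ seq (γ⟨_⟩ G x) m
        edge≤ e = ∈⇒≤max m (∈-map⁺ (λ (u , v) → ∣ x u -ℝ x v ∣ℝ) e)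
        steps≤ : ∀ {u v} → u ~ v → ∣ q u - q v ∣ ≤ seq (γ⟨_⟩ G x) m
        steps≤ {u} {v} u~v = [ edge≤ , (λ e → subst (_≤ seq (γ⟨_⟩ G x) m) (∣p-q∣-comm (q v) (q u)) (edge≤ e)) ]′
          (~⇒∈-edges G u~v)
        large-entry : ∃[ w ] (+ 19 / 20 ≤ ∣ q w ∣)
        large-entry =
          let y , y∈ , norm≡y = max-attained m (map (λ v → ∣ x v ∣ℝ) (allFin n)) (ℚ.<-≤-trans (ℚ.positive⁻¹ (+ 19 / 20)) norm-large)
              w , _ , y≡∣xw∣  = ∈-map⁻ (λ v → ∣ x v ∣ℝ) y∈
          in w , subst (+ 19 / 20 ≤_) (trans norm≡y (cong (λ z → seq z m) y≡∣xw∣)) norm-large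

    -- Expanding `(s + δ)(γ + δ)` leaves the error `(s + γ)δ + δ²`, at most `(K + L)δ + δ` since
    -- `δ ≤ 1`, and hence at most `h/8`. From `5/4` there remains `9/8`, which still exceeds
    -- `17/16 = 1 + 1/16`.
    absorb-errors : ∀ {s γ g δ K L} → 0ℚ ≤ δ → δ ≤ 1ℚ → 0ℚ ≤ s → ∣ s ∣ ≤ K → ∣ γ ∣ ≤ L → g ≤ γ + δ →
      (K + L) * δ + 1ℚ * δ ≤ (+ 1 / 8) * h → (+ 5 / 4) * h ≤ (s + δ) * g → h + (+ 1 / 16) * h < s * γ
    absorb-errors {s} {γ} {g} {δ} {K} {L} 0≤δ δ≤1 0≤s s≤K γ≤L g≤γ+δ errors≤ bound = begin-strict
      h + (+ 1 / 16) * h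
        ≡⟨ solve 1 (λ h → h :+ con (+ 1 / 16) :* h := con (+ 17 / 16) :* h) refl h ⟩
      (+ 17 / 16) * h
        <⟨ ℚ.*-monoˡ-<-pos h {{positive h>0}} (toWitness {a? = (+ 17 / 16) ℚ.<? (+ 9 / 8)} _) ⟩
      (+ 9 / 8) * h
        ≡⟨ solve 1 (λ h → con (+ 9 / 8) :* h := con (+ 5 / 4) :* h :- con (+ 1 / 8) :* h) refl h ⟩
      (+ 5 / 4) * h - (+ 1 / 8) * h
        ≤⟨ ℚ.+-mono-≤ bound (ℚ.neg-antimono-≤ errors≤) ⟩
      (s + δ) * g - ((K + L) * δ + 1ℚ * δ)
        ≤⟨ ℚ.+-mono-≤ (ℚ.*-monoˡ-≤-nonNeg (s + δ) {{nonNegative (ℚ.+-mono-≤ 0≤s 0≤δ)}} g≤γ+δ)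
             (ℚ.neg-antimono-≤ (ℚ.+-mono-≤
               (ℚ.*-monoʳ-≤-nonNeg δ {{nonNegative 0≤δ}} (ℚ.+-mono-≤ (ℚ.≤-trans (p≤∣p∣ s) s≤K) (ℚ.≤-trans (p≤∣p∣ γ) γ≤L)))
               (ℚ.*-monoʳ-≤-nonNeg δ {{nonNegative 0≤δ}} δ≤1))) ⟩
      (s + δ) * (γ + δ) - ((s + γ) * δ + δ * δ)
        ≡⟨ solve 3 (λ s γ δ → (s :+ δ) :* (γ :+ δ) :- ((s :+ γ) :* δ :+ δ :* δ) := s :* γ) refl s γ δ ⟩
      s * γ ∎
      where
      open ℚ.≤-Reasoning
      open +-*-Solver

    module _ {γ : ℝ} {x : Fin n → ℝ} (x∈𝓕 : 𝓕 x) (γx≃γ : γ⟨_⟩ G x ≃ℝ γ) where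

      private
        gap : ℚ
        gap = (+ 1 / 16) * h

        Bounded : ℝ → Set
        Bounded y = ∃[ K ] (0ℚ < K × Eventually (λ m → ∣ seq y m ∣ ≤ K))

      eventually-gap : ∀ {K L δ} → 0ℚ < δ → δ ≤ + 1 / 20 → (K + L) * δ + 1ℚ * δ ≤ (+ 1 / 8) * h →
        Eventually (λ m → ∣ √-approx (n ℕ.∸ 1) m ∣ ≤ K) → Eventually (λ m → ∣ seq γ m ∣ ≤ L) →
        Eventually (λ m → h + gap < √-approx (n ℕ.∸ 1) m * seq γ m)
      eventually-gap {δ = δ} δ>0 δ≤1/20 errors≤ s≤K γ≤L = eventually-map
        (λ m ((s≤K , γ≤L) , (sum≈0 , norm≈1) , γx≈γ , 1/m≤δ) →
          absorb-errors (ℚ.<⇒≤ δ>0) (ℚ.≤-trans δ≤1/20 (toWitness {a? = (+ 1 / 20) ℚ.≤? 1ℚ} _))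
            (0≤√-approx (n ℕ.∸ 1) m) s≤K γ≤L
            (ℚ.<⇒≤ (∣p-q∣<ε⇒p<q+ε {seq (γ⟨_⟩ G x) m} {seq γ m} γx≈γ)) errors≤
            (index-bound x m δ δ≤1/20 sum≈0 norm≈1 1/m≤δ))
        (eventually-× (eventually-× s≤K γ≤L)
          (eventually-× (eventually-× (proj₁ x∈𝓕 δ δ>0) (proj₂ x∈𝓕 δ δ>0))
            (eventually-× (γx≃γ δ δ>0) (eventually-1/m≤ δ>0))))

      -- The bounds `K` and `L` do not depend on the index, so `δ` can be fixed in advance and the
      -- gap `h/16` is the same at all large indices.
      cheeger<√*γ : Bounded (√ (n ℕ.∸ 1)) → Bounded γ → fromℚ h <ℝ √ (n ℕ.∸ 1) *ℝ γ
      cheeger<√*γ (K , K>0 , s≤K) (L , L>0 , γ≤L) = gap , scaled>0 (+ 1 / 16) ,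
        with-δ (divide (K + L) 1ℚ ((+ 1 / 8) * h) K+L>0 0<1 (scaled>0 (+ 1 / 8)))
        where
        K+L>0 : 0ℚ < K + L
        K+L>0 = ℚ.+-mono-< K>0 L>0
        scaled>0 : ∀ r .{{_ : ℚ.Positive r}} → 0ℚ < r * h
        scaled>0 r = ℚ.positive⁻¹ (r * h) {{ℚ.pos*pos⇒pos r h {{positive h>0}}}}
        ⊓-pos : ∀ {p q} → 0ℚ < p → 0ℚ < q → 0ℚ < p ⊓ q
        ⊓-pos {p} {q} p>0 q>0 = [ (λ eq → subst (0ℚ <_) (sym eq) p>0) , (λ eq → subst (0ℚ <_) (sym eq) q>0) ]′ (ℚ.⊓-sel p q)
        with-δ : ∃[ δ ] (0ℚ < δ × (K + L) * δ + 1ℚ * δ ≡ (+ 1 / 8) * h) →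
                 Eventually (λ m → h + gap < √-approx (n ℕ.∸ 1) m * seq γ m)
        -- `divide` makes the error exactly `h/8`; taking the minimum with `1/20` only lowers it and
        -- also meets the tolerance on the sum and the norm.
        with-δ (δ , δ>0 , errors≡) = eventually-gap (⊓-pos δ>0 (ℚ.positive⁻¹ (+ 1 / 20))) (ℚ.p⊓q≤q δ (+ 1 / 20))
          (ℚ.≤-trans
            (ℚ.+-mono-≤ (ℚ.*-monoˡ-≤-nonNeg (K + L) {{nonNegative (ℚ.<⇒≤ K+L>0)}} (ℚ.p⊓q≤p δ (+ 1 / 20)))
                        (ℚ.*-monoˡ-≤-nonNeg 1ℚ (ℚ.p⊓q≤p δ (+ 1 / 20))))
            (ℚ.≤-reflexive errors≡))
          s≤K γ≤L

open import Data.Nat using (ℕ; _≤_; _∸_)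
open import Data.Rational using (ℚ)
open Rational using (cheeger<√*γ)

theorem4p6 : ∀ (n k : ℕ) (G : Graph n) → 2 ≤ n → Connected G → Regular G k →
    ∀ (h : ℚ) (γ : ℝ) → IsCheegerConstant G h → Isγ G γ →
    fromℚ h <ℝ √ (n ∸ 1) *ℝ γ
theorem4p6 n k G _ connected regular h γ h-cheeger ((x , x∈𝓕 , γx≃γ) , _) =
  cheeger<√*γ G connected regular h-cheeger {γ} {x} x∈𝓕 γx≃γ (eventuallyBounded (√ (n ∸ 1))) (eventuallyBounded γ)
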